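{- Let $n\ge2$, let $F_n$ be the free group on $z_1,\dots,z_n$, let $V_m=(v_1,\dots,v_m)$ be a tuple of words in $F_n$ at least one of which is nontrivial in $F_n$, and let $N$ be the normal closure of $\{v_1,\dots,v_m\}$ in $F_n$. Let $a,b$ be words in $F_n$. Then $FTL_{s2}(F_n,V_m,a)$ and $FTL_{s2}(F_n,V_m,b)$ are Hurwitz equivalent if and only if $a^{ -1}b\in N$.
   Context: Conjugation notation: $a^b=b^{ -1}ab$. An element $A$ of a free group has a root if $A=w^k$ for some $w$ and some integer $k\neq\pm1$. For $G_1\oplus G_2$, $R=(R_1,\dots,R_p)$, $W=(W_1,\dots,W_q)$, $H$ in $G_1$ and $X=(X_1,\dots,X_{q+2})$ in $G_2$, let $P_X(R,W,H)=((R_1,1),\dots,(R_p,1),(W_1,X_1),\dots,(W_q,X_q),(H^{ -1},X_{q+1}),(H,X_{q+2}))$. Let $F_X$ be free on $X_1,\dots,X_{n+1}$ and fix an injective homomorphism $i:F_n\oplus F_X\to F_2\oplus F_2$. For a word $c$ in $F_n$, $FTL_{s1}(F_n,V_m,c)=i(P_X(V_f,W,c))$ with $V_f=(v_1,\dots,v_m,(v_1\cdots v_m)^{ -1})$, $W=(z_1,\dots,z_n,(z_1\cdots z_n)^{ -1})$, $X=(X_1,\dots,X_n,(X_1\cdots X_n)^{ -1},X_{n+1}^{ -1},X_{n+1})$. Fix an element $H\in N$ with no root (one exists), and define $FTL_{s2}(F_n,V_m,c)=FTL_{s1}(F_n,V_m,H^c)$. The braid group acts on the right on tuples by $(f_1,\dots,f_k)\sigma_i=(\dots,f_{i-1},f_{i+1},f_{i+1}^{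 -1}f_if_{i+1},f_{i+2},\dots)$, $(f_1,\dots,f_k)\sigma_i^{ -1}=(\dots,f_{i-1},f_if_{i+1}f_i^{ -1},f_i,f_{i+2},\dots)$; Hurwitz equivalent means in the same orbit. -}

module Defs where

open import Data.Nat using (ℕ; suc; _≤_; _+_)
open import Data.Fin using (Fin; fromℕ; inject₁)
open import Data.Bool using (Bool; true; false; not)
open import Data.Product using (_×_; _,_; ∃; ∃-syntax; proj₁; proj₂)
open import Data.Sum using (_⊎_)
open import Data.List using (List; []; _∷_; _++_; reverse; map; zipWith; foldr)
open import Data.Vec as V using (Vec; lookup; toList; _∷ʳ_)
open import Data.Integer as ℤ using (ℤ; +_; -[1+_]; -_)
open import Data.List.Relation.Binary.Pointwise using (Pointwise)
open import Relation.Binary.PropositionalEquality using (_≡_)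
open import Relation.Nullary using (¬_)
open import Function.Bundles using (_⇔_)

-- Free group on generators Fin k, as words modulo free reduction.

-- A letter: generator index together with an exponent sign
-- (false = the generator itself, true = its inverse).
Letter : ℕ → Set
Letter k = Fin k × Bool

Word : ℕ → Set
Word k = List (Letter k)

invL : ∀ {k} → Letter k → Letter k
invL (x , e) = (x , not e)

ε : ∀ {k} → Word k
ε = []

_·_ : ∀ {k} → Word k → Word k → Word k
u · v = u ++ v
infixl 7 _·_

_⁻¹ : ∀ {k} → Word k → Word k
w ⁻¹ = reverse (map invL w)
infix 8 _⁻¹

gen : ∀ {k} → Fin k → Word k
gen x = (x , false) ∷ []

data _≈_ {k : ℕ} : Word k → Word k → Set where
  ≈-refl  : ∀ {u} → u ≈ u
  ≈-sym   : ∀ {u v} → u ≈ v → v ≈ u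
  ≈-trans : ∀ {u v w} → u ≈ v → v ≈ w → u ≈ w
  ≈-cancel : ∀ u (x : Letter k) v → (u ++ (x ∷ invL x ∷ v)) ≈ (u ++ v)
infix 4 _≈_

_^_ : ∀ {k} → Word k → Word k → Word k
a ^ b = b ⁻¹ · a · b

powℕ : ∀ {k} → Word k → ℕ → Word k
powℕ w ℕ.zero = ε
powℕ w (suc j) = w · powℕ w j

pow : ∀ {k} → Word k → ℤ → Word k
pow w (+ j) = powℕ w j
pow w -[1+ j ] = powℕ (w ⁻¹) (suc j)

HasRoot : ∀ {k} → Word k → Set
HasRoot {k} A = ∃[ w ] ∃[ e ] (¬ e ≡ + 1 × ¬ e ≡ - (+ 1) × A ≈ pow w e)

data InNormalClosure {k m : ℕ} (V : Vec (Word k) m) : Word k → Set where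
  nc-gen  : ∀ j → InNormalClosure V (lookup V j)
  nc-one  : InNormalClosure V ε
  nc-mul  : ∀ {u v} → InNormalClosure V u → InNormalClosure V v → InNormalClosure V (u · v)
  nc-inv  : ∀ {u} → InNormalClosure V u → InNormalClosure V (u ⁻¹)
  nc-conj : ∀ {u} g → InNormalClosure V u → InNormalClosure V (u ^ g)
  nc-resp : ∀ {u v} → u ≈ v → InNormalClosure V u → InNormalClosure V v

Pair : ℕ → ℕ → Set
Pair k l = Word k × Word l

_≈₂_ : ∀ {k l} → Pair k l → Pair k l → Set
(a , b) ≈₂ (c , d) = (a ≈ c) × (b ≈ d)
infix 4 _≈₂_

_·₂_ : ∀ {k l} → Pair k l → Pair k l → Pair k l
(a , b) ·₂ (c , d) = (a · c , b · d)
infixl 7 _·₂_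

_⁻¹₂ : ∀ {k l} → Pair k l → Pair k l
(a , b) ⁻¹₂ = (a ⁻¹ , b ⁻¹)
infix 8 _⁻¹₂

record IsInjectiveHom {k l k' l' : ℕ} (f : Pair k l → Pair k' l') : Set where
  field
    resp     : ∀ {x y} → x ≈₂ y → f x ≈₂ f y
    hom      : ∀ x y → f (x ·₂ y) ≈₂ (f x ·₂ f y)
    injective : ∀ {x y} → f x ≈₂ f y → x ≈₂ y

G : Set
G = Pair 2 2

data Hurwitz : List G → List G → Set where
  h-eq    : ∀ {s t} → Pointwise _≈₂_ s t → Hurwitz s t
  h-σ     : ∀ pre f g post →
            Hurwitz (pre ++ f ∷ g ∷ post) (pre ++ g ∷ (g ⁻¹₂ ·₂ f ·₂ g) ∷ post)
  h-σ⁻¹   : ∀ pre f g post →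
            Hurwitz (pre ++ f ∷ g ∷ post) (pre ++ (f ·₂ g ·₂ f ⁻¹₂) ∷ f ∷ post)
  h-sym   : ∀ {s t} → Hurwitz s t → Hurwitz t s
  h-trans : ∀ {s t u} → Hurwitz s t → Hurwitz t u → Hurwitz s u

P : ∀ {k l p q} → Vec (Word k) p → Vec (Word k) q → Word k → Vec (Word l) (q + 2)
    → List (Pair k l)
P {q = q} R W H X with V.drop q X
... | Xq1 V.∷ Xq2 V.∷ V.[] =
  map (λ r → (r , ε)) (toList R)
  ++ toList (V.zipWith _,_ W (V.take q X))
  ++ (H ⁻¹ , Xq1) ∷ (H , Xq2) ∷ []

prod : ∀ {k m} → Vec (Word k) m → Word k
prod = V.foldr _ _·_ ε

Vf : ∀ {k m} → Vec (Word k) m → Vec (Word k) (suc m)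
Vf V = V ∷ʳ (prod V ⁻¹)

Wz : (n : ℕ) → Vec (Word n) (suc n)
Wz n = let z = V.tabulate gen in z ∷ʳ (prod z ⁻¹)

Xs : (n : ℕ) → Vec (Word (suc n)) (suc n + 2)
Xs n = let x = V.tabulate (λ j → gen (inject₁ j))
           xl = gen (fromℕ n)
       in (x ∷ʳ (prod x ⁻¹)) V.++ (xl ⁻¹ V.∷ xl V.∷ V.[])

FTLs1 : ∀ {n m} → (Pair n (suc n) → G) → Vec (Word n) m → Word n → List G
FTLs1 {n} i V c = map i (P (Vf V) (Wz n) c (Xs n))

FTLs2 : ∀ {n m} → (Pair n (suc n) → G) → Vec (Word n) m → Word n → Word n → List G
FTLs2 i V H c = FTLs1 i V (H ^ c)

{-# OPTIONS --safe #-}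
-- The entries of a tuple fall into three consecutive blocks, each with trivial product.  Such a block
-- commutes past its neighbours and can be conjugated by any of them.  Conjugating the first block
-- by the middle one turns the v_j into arbitrary conjugates, and these conjugate the last block, so
-- the marked word c may be replaced by c^u for every u ∈ N.
--
-- Conversely, modulo N the entries generate the graph of the homomorphism φ with X_j ↦ z_j and
-- X_{n+1} ↦ 1.  The exponent sum of X_{n+1} singles out the marked entry (H^a, X_{n+1}), so an
-- equivalence conjugates it to (H^b, X_{n+1}) by some (p, q) with p ≡ φ(q).  Then q centralizes
-- X_{n+1}, hence is a power of it, and p ∈ N; and a p b⁻¹ centralizes H, hence is a power of H ∈ N.
module Submission where

open import Defs
open import Algebra.Bundles using (Group; AbelianGroup)
import Algebra.Construct.DirectProduct as DirectProduct
import Algebra.Properties.Group as GroupProperties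
open import Data.Bool using (true; false)
import Data.Bool.Properties as Bool
open import Data.Fin using (Fin; fromℕ; inject₁)
import Data.Fin.Properties as Fin
open import Data.Fin.Relation.Unary.Top using (View; view; ‵fromℕ; ‵inject₁; view-fromℕ; view-inject₁)
open import Data.Integer as ℤ using (ℤ; +_; -[1+_])
import Data.Integer.Properties as ℤ
open import Data.List using (List; []; _∷_; _++_; [_]; map; reverse; length; foldr; last)
open import Data.List.Membership.Propositional using (_∈_)
open import Data.List.Membership.Propositional.Properties using (∈-map⁺)
open import Data.List.Properties using
  (++-assoc; ++-identityʳ; ++-cancelˡ; ∷-injective; foldr-++; length-++;
   map-++; map-∘; map-id; reverse-++; unfold-reverse)
open import Data.List.Relation.Binary.Pointwise as Pointwise using (Pointwise; []; _∷_)
open import Data.List.Relation.Unary.All as All using (All; []; _∷_)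
import Data.List.Relation.Unary.All.Properties as All
open import Data.List.Relation.Unary.Any using (here; there)
open import Data.List.Relation.Unary.Linked using (Linked; []; [-]; _∷_)
import Data.List.Relation.Unary.Linked.Properties as Linked
open import Data.Maybe using (just)
open import Data.Maybe.Relation.Binary.Connected using (Connected; just)
open import Data.Nat as ℕ using (ℕ; zero; suc; s≤s; z≤n; _≤_; _+_)
import Data.Nat.Properties as ℕ
open import Data.Product using (_×_; _,_; ∃-syntax; proj₁; proj₂)
open import Data.Product.Properties using (≡-dec)
open import Data.Sum using (_⊎_; inj₁; inj₂)
open import Data.Vec as Vec using (Vec; lookup; _∷_; [])
import Data.Vec.Membership.Propositional.Properties as VecMembership
open import Data.Vec.Properties using (lookup∘tabulate; lookup-zipWith)
import Data.Vec.Relation.Unary.All.Properties as VecAll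
open import Function using (_∘_; case_of_)
open import Function.Bundles using (_⇔_; mk⇔)
open import Relation.Binary.Definitions using (DecidableEquality)
open import Relation.Binary.PropositionalEquality
  using (_≡_; _≢_; refl; sym; trans; cong; cong₂; subst; subst₂; module ≡-Reasoning)
open import Relation.Nullary using (¬_; yes; no; contradiction)

private variable
  k l : ℕ

-- The free group and its universal property

≡⇒≈ : {u v : Word k} → u ≡ v → u ≈ v
≡⇒≈ refl = ≈-refl

·-congʳ : {u v : Word k} (w : Word k) → u ≈ v → u · w ≈ v · w
·-congʳ w ≈-refl = ≈-refl
·-congʳ w (≈-sym p) = ≈-sym (·-congʳ w p)
·-congʳ w (≈-trans p q) = ≈-trans (·-congʳ w p) (·-congʳ w q)
·-congʳ w (≈-cancel u x v) =
  subst₂ _≈_ (sym (++-assoc u (x ∷ invL x ∷ v) w)) (sym (++-assoc u v w)) (≈-cancel u x (v ++ w))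

·-congˡ : (w : Word k) {u v : Word k} → u ≈ v → w · u ≈ w · v
·-congˡ w ≈-refl = ≈-refl
·-congˡ w (≈-sym p) = ≈-sym (·-congˡ w p)
·-congˡ w (≈-trans p q) = ≈-trans (·-congˡ w p) (·-congˡ w q)
·-congˡ w (≈-cancel u x v) =
  subst₂ _≈_ (++-assoc w u (x ∷ invL x ∷ v)) (++-assoc w u v) (≈-cancel (w ++ u) x v)

invL-involutive : (x : Letter k) → invL (invL x) ≡ x
invL-involutive (x , e) = cong (x ,_) (Bool.not-involutive e)

invL-irrefl : (x : Letter k) → x ≢ invL x
invL-irrefl (x , e) p = Bool.not-¬ refl (cong proj₂ p)

⁻¹-∷ : (x : Letter k) (w : Word k) → (x ∷ w) ⁻¹ ≡ w ⁻¹ ++ [ invL x ]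
⁻¹-∷ x w = unfold-reverse (invL x) (map invL w)

⁻¹-++ : (u v : Word k) → (u ++ v) ⁻¹ ≡ v ⁻¹ ++ u ⁻¹
⁻¹-++ u v = trans (cong reverse (map-++ invL u v)) (reverse-++ (map invL u) (map invL v))

·-inverseʳ : (u : Word k) → u · u ⁻¹ ≈ ε
·-inverseʳ [] = ≈-refl
·-inverseʳ (x ∷ u) = ≈-trans
  (≡⇒≈ (cong (x ∷_) (trans (cong (u ++_) (⁻¹-∷ x u)) (sym (++-assoc u (u ⁻¹) _)))))
  (≈-trans (·-congˡ [ x ] (·-congʳ [ invL x ] (·-inverseʳ u))) (≈-cancel [] x []))

·-inverseˡ : (u : Word k) → u ⁻¹ · u ≈ ε
·-inverseˡ [] = ≈-refl
·-inverseˡ (x ∷ u) = ≈-trans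
  (≡⇒≈ (trans (cong (_++ x ∷ u) (⁻¹-∷ x u)) (++-assoc (u ⁻¹) _ _)))
  (≈-trans (·-congˡ (u ⁻¹) (≈-trans (≡⇒≈ (cong (λ y → invL x ∷ y ∷ u) (sym (invL-involutive x)))) (≈-cancel [] (invL x) u)))
           (·-inverseˡ u))

-- Uniqueness of inverses: `u ⁻¹ ≈ u ⁻¹ · v · v ⁻¹ ≈ u ⁻¹ · u · v ⁻¹ ≈ v ⁻¹`.
⁻¹-cong-≈ : {u v : Word k} → u ≈ v → u ⁻¹ ≈ v ⁻¹
⁻¹-cong-≈ {u = u} {v} p =
  ≈-trans (≈-trans (≈-sym (≡⇒≈ (++-identityʳ _))) (·-congˡ (u ⁻¹) (≈-sym (·-inverseʳ v))))
  (≈-trans (≈-trans (·-congˡ (u ⁻¹) (·-congʳ (v ⁻¹) (≈-sym p))) (≡⇒≈ (sym (++-assoc (u ⁻¹) u _))))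
           (·-congʳ (v ⁻¹) (·-inverseˡ u)))

-- Stated for an arbitrary predicate because it serves both `N` and, later, the words that lie over
-- `ε` on the graph of `φ`.
pow-closed : (S : Word k → Set) → S ε → (∀ {u v} → S u → S v → S (u · v)) → (∀ {u} → S u → S (u ⁻¹)) →
             ∀ {w} → S w → ∀ e → S (pow w e)
pow-closed S one mul inv {w} s = go
  where
  iter : ∀ {u} → S u → ∀ j → S (powℕ u j)
  iter t zero    = one
  iter t (suc j) = mul t (iter t j)
  go : ∀ e → S (pow w e)
  go (+ j)    = iter s j
  go -[1+ j ] = iter (inv s) (suc j)

freeGroup : ℕ → Group _ _
freeGroup k = record
  { Carrier = Word k ; _≈_ = _≈_ ; _∙_ = _·_ ; ε = ε ; _⁻¹ = _⁻¹
  ; isGroup = record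
    { isMonoid = record
      { isSemigroup = record
        { isMagma = record
          { isEquivalence = record { refl = ≈-refl ; sym = ≈-sym ; trans = ≈-trans }
          ; ∙-cong = λ {x} {y} {u} {v} p q → ≈-trans (·-congʳ u p) (·-congˡ y q) }
        ; assoc = λ u v w → ≡⇒≈ (++-assoc u v w) }
      ; identity = (λ _ → ≈-refl) , (λ u → ≡⇒≈ (++-identityʳ u)) }
    ; inverse = ·-inverseˡ , ·-inverseʳ
    ; ⁻¹-cong = ⁻¹-cong-≈ } }

module Lift {a b} (𝔾 : Group a b) where
  private
    module 𝔾 = Group 𝔾
  open GroupProperties 𝔾 using (⁻¹-involutive; inverseˡ-unique)
  open import Relation.Binary.Reasoning.Setoid 𝔾.setoid

  module _ {k} (f : Fin k → 𝔾.Carrier) where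
    liftL : Letter k → 𝔾.Carrier
    liftL (x , false) = f x
    liftL (x , true)  = f x 𝔾.⁻¹

    lift : Word k → 𝔾.Carrier
    lift []      = 𝔾.ε
    lift (x ∷ w) = liftL x 𝔾.∙ lift w

    lift-· : ∀ u v → lift (u · v) 𝔾.≈ (lift u 𝔾.∙ lift v)
    lift-· []      v = 𝔾.sym (𝔾.identityˡ _)
    lift-· (x ∷ u) v = 𝔾.trans (𝔾.∙-congˡ (lift-· u v)) (𝔾.sym (𝔾.assoc _ _ _))

    liftL-invL : ∀ x → liftL (invL x) 𝔾.≈ liftL x 𝔾.⁻¹
    liftL-invL (x , false) = 𝔾.refl
    liftL-invL (x , true)  = 𝔾.sym (⁻¹-involutive (f x))

    lift-cong : ∀ {u v} → u ≈ v → lift u 𝔾.≈ lift v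
    lift-cong ≈-refl = 𝔾.refl
    lift-cong (≈-sym p) = 𝔾.sym (lift-cong p)
    lift-cong (≈-trans p q) = 𝔾.trans (lift-cong p) (lift-cong q)
    lift-cong (≈-cancel u x v) = begin
      lift (u · (x ∷ invL x ∷ v))                           ≈⟨ lift-· u _ ⟩
      lift u 𝔾.∙ (liftL x 𝔾.∙ (liftL (invL x) 𝔾.∙ lift v))  ≈⟨ 𝔾.∙-congˡ (𝔾.assoc _ _ _) ⟨
      lift u 𝔾.∙ ((liftL x 𝔾.∙ liftL (invL x)) 𝔾.∙ lift v)
        ≈⟨ 𝔾.∙-congˡ (𝔾.∙-congʳ (𝔾.trans (𝔾.∙-congˡ (liftL-invL x)) (𝔾.inverseʳ _))) ⟩
      lift u 𝔾.∙ (𝔾.ε 𝔾.∙ lift v)                           ≈⟨ 𝔾.∙-congˡ (𝔾.identityˡ _) ⟩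
      lift u 𝔾.∙ lift v                                     ≈⟨ lift-· u v ⟨
      lift (u · v)                                          ∎

    lift-⁻¹ : ∀ u → lift (u ⁻¹) 𝔾.≈ lift u 𝔾.⁻¹
    lift-⁻¹ u = inverseˡ-unique _ _
      (𝔾.trans (𝔾.sym (lift-· (u ⁻¹) u)) (lift-cong (·-inverseˡ u)))

-- Reduced words

_≟L_ : DecidableEquality (Letter k)
_≟L_ = ≡-dec Fin._≟_ Bool._≟_

NoCancel : Letter k → Letter k → Set
NoCancel x y = y ≢ invL x

Reduced : Word k → Set
Reduced = Linked NoCancel

push : Letter k → Word k → Word k
push x [] = [ x ]
push x (y ∷ w) with y ≟L invL x
... | yes _ = w
... | no  _ = x ∷ y ∷ w

nf : Word k → Word k
nf = foldr push []

reduced-tail : ∀ {x : Letter k} {w} → Reduced (x ∷ w) → Reduced w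
reduced-tail [-]     = []
reduced-tail (_ ∷ r) = r

push-reduced : ∀ (x : Letter k) {w} → Reduced w → Reduced (push x w)
push-reduced x {[]} r = [-]
push-reduced x {y ∷ w} r with y ≟L invL x
... | yes _ = reduced-tail r
... | no  p = p ∷ r

push-≈ : ∀ (x : Letter k) w → push x w ≈ x ∷ w
push-≈ x [] = ≈-refl
push-≈ x (y ∷ w) with y ≟L invL x
... | yes refl = ≈-sym (≈-cancel [] x w)
... | no  _    = ≈-refl

push-∷ : ∀ {x : Letter k} {w} → Reduced (x ∷ w) → push x w ≡ x ∷ w
push-∷ [-] = refl
push-∷ {x = x} {y ∷ w} (p ∷ r) with y ≟L invL x
... | yes q = contradiction q p
... | no  _ = refl

-- Van der Waerden's argument: letters act on reduced words by bijections, `x` and `invL x` being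
-- mutually inverse. Reducedness matters when `w` begins with `x`: the letter after it is not
-- `invL x`, so pushing `x` back restores it.
push-invL : ∀ (x : Letter k) {w} → Reduced w → push x (push (invL x) w) ≡ w
push-invL x {[]} r with invL x ≟L invL x
... | yes _ = refl
... | no  p = contradiction refl p
push-invL x {y ∷ w} r with y ≟L invL (invL x)
... | yes refl = trans (cong (λ z → push z w) (sym (invL-involutive x))) (push-∷ r)
... | no  _ with invL x ≟L invL x
...   | yes _ = refl
...   | no  p = contradiction refl p

push-length : ∀ (x : Letter k) w → length (push x w) ≤ suc (length w)
push-length x [] = ℕ.≤-refl
push-length x (y ∷ w) with y ≟L invL x
... | yes _ = ℕ.m≤n⇒m≤1+n (ℕ.n≤1+n _)
... | no  _ = ℕ.≤-refl

nf-reduced : ∀ (w : Word k) → Reduced (nf w)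
nf-reduced []      = []
nf-reduced (x ∷ w) = push-reduced x (nf-reduced w)

nf-≈ : ∀ (w : Word k) → nf w ≈ w
nf-≈ []      = ≈-refl
nf-≈ (x ∷ w) = ≈-trans (push-≈ x (nf w)) (·-congˡ [ x ] (nf-≈ w))

nf-fixed : ∀ {w : Word k} → Reduced w → nf w ≡ w
nf-fixed {w = []} r = refl
nf-fixed {w = x ∷ w} r = trans (cong (push x) (nf-fixed (reduced-tail r))) (push-∷ r)

nf-cong : ∀ {u v : Word k} → u ≈ v → nf u ≡ nf v
nf-cong ≈-refl = refl
nf-cong (≈-sym p) = sym (nf-cong p)
nf-cong (≈-trans p q) = trans (nf-cong p) (nf-cong q)
nf-cong (≈-cancel u x v) = begin
  nf (u ++ x ∷ invL x ∷ v)                         ≡⟨ foldr-++ push [] u _ ⟩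
  foldr push (push x (push (invL x) (nf v))) u     ≡⟨ cong (λ w → foldr push w u) (push-invL x (nf-reduced v)) ⟩
  foldr push (nf v) u                              ≡⟨ foldr-++ push [] u v ⟨
  nf (u ++ v)                                      ∎
  where open ≡-Reasoning

nf-length : ∀ (w : Word k) → length (nf w) ≤ length w
nf-length []      = z≤n
nf-length (x ∷ w) = ℕ.≤-trans (push-length x (nf w)) (s≤s (nf-length w))

nf-complete : ∀ {u v : Word k} → nf u ≡ nf v → u ≈ v
nf-complete {u = u} {v} p = ≈-trans (≈-sym (nf-≈ u)) (≈-trans (≡⇒≈ p) (nf-≈ v))

reduced-≈⇒≡ : ∀ {u v : Word k} → Reduced u → Reduced v → u ≈ v → u ≡ v
reduced-≈⇒≡ r s p = trans (sym (nf-fixed r)) (trans (nf-cong p) (nf-fixed s))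

-- Normalising never lengthens a word, and it fixes reduced words.
reduced-shortest : ∀ {u v : Word k} → Reduced u → u ≈ v → length u ≤ length v
reduced-shortest {v = v} r p =
  subst (λ w → length w ≤ length v) (trans (sym (nf-cong p)) (nf-fixed r)) (nf-length v)

last-∷ʳ : ∀ {A : Set} (xs : List A) x → last (xs ++ [ x ]) ≡ just x
last-∷ʳ [] x = refl
last-∷ʳ (y ∷ []) x = refl
last-∷ʳ (y ∷ z ∷ xs) x = last-∷ʳ (z ∷ xs) x

reduced-++ : ∀ {u v : Word k} {x y} → Reduced (u ++ [ x ]) → Reduced (y ∷ v) →
             NoCancel x y → Reduced ((u ++ [ x ]) ++ y ∷ v)
reduced-++ {u = u} {x = x} {y} r s p =
  Linked.++⁺ r (subst (λ m → Connected NoCancel m (just y)) (sym (last-∷ʳ u x)) (just p)) s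

reduced-⁻¹ : ∀ {w : Word k} → Reduced w → Reduced (w ⁻¹)
reduced-⁻¹ [] = []
reduced-⁻¹ [-] = [-]
reduced-⁻¹ {w = x ∷ y ∷ w} (p ∷ r) =
  subst Reduced (sym (trans (⁻¹-∷ x (y ∷ w)) (cong (_++ [ invL x ]) (⁻¹-∷ y w))))
    (reduced-++ {u = w ⁻¹} (subst Reduced (⁻¹-∷ y w) (reduced-⁻¹ r)) [-]
      (λ q → p (trans (sym (invL-involutive y)) (sym q))))

-- An identity of groups holds everywhere once it holds in the free group on its variables,
-- where normal forms decide it.

infixl 7 _⊙_
infix 8 _⊖ _^ᵉ_

data Expr (k : ℕ) : Set where
  var  : Fin k → Expr k
  𝟙    : Expr k
  _⊙_  : Expr k → Expr k → Expr k
  _⊖   : Expr k → Expr k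

_^ᵉ_ : Expr k → Expr k → Expr k
x ^ᵉ g = g ⊖ ⊙ x ⊙ g

⟦_⟧ : Expr k → Word k
⟦ var x ⟧ = gen x
⟦ 𝟙 ⟧     = ε
⟦ e ⊙ f ⟧ = ⟦ e ⟧ · ⟦ f ⟧
⟦ e ⊖ ⟧   = ⟦ e ⟧ ⁻¹

module Solver {a b} (𝔾 : Group a b) where
  private
    module 𝔾 = Group 𝔾
  open Lift 𝔾

  eval : (Fin k → 𝔾.Carrier) → Expr k → 𝔾.Carrier
  eval ρ (var x) = ρ x
  eval ρ 𝟙       = 𝔾.ε
  eval ρ (e ⊙ f) = eval ρ e 𝔾.∙ eval ρ f
  eval ρ (e ⊖)   = eval ρ e 𝔾.⁻¹

  eval-lift : (ρ : Fin k → 𝔾.Carrier) (e : Expr k) → eval ρ e 𝔾.≈ lift ρ ⟦ e ⟧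
  eval-lift ρ (var x) = 𝔾.sym (𝔾.identityʳ _)
  eval-lift ρ 𝟙       = 𝔾.refl
  eval-lift ρ (e ⊙ f) = 𝔾.trans (𝔾.∙-cong (eval-lift ρ e) (eval-lift ρ f)) (𝔾.sym (lift-· ρ ⟦ e ⟧ ⟦ f ⟧))
  eval-lift ρ (e ⊖)   = 𝔾.trans (𝔾.⁻¹-cong (eval-lift ρ e)) (𝔾.sym (lift-⁻¹ ρ ⟦ e ⟧))

  solve : (ρ : Vec 𝔾.Carrier k) (e f : Expr k) → nf ⟦ e ⟧ ≡ nf ⟦ f ⟧ →
          eval (lookup ρ) e 𝔾.≈ eval (lookup ρ) f
  solve ρ e f p = 𝔾.trans (eval-lift (lookup ρ) e)
    (𝔾.trans (lift-cong (lookup ρ) (nf-complete {u = ⟦ e ⟧} {⟦ f ⟧} p)) (𝔾.sym (eval-lift (lookup ρ) f)))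

pattern v₀ = var Fin.zero
pattern v₁ = var (Fin.suc Fin.zero)
pattern v₂ = var (Fin.suc (Fin.suc Fin.zero))
pattern v₃ = var (Fin.suc (Fin.suc (Fin.suc Fin.zero)))

-- Commuting elements

Cyc : Word k → Word k → Set
Cyc w x = ∃[ e ] x ≈ pow w e

module _ {k : ℕ} where
  open Group (freeGroup k) using (assoc; identityʳ; ⁻¹-cong)
  open GroupProperties (freeGroup k) using (⁻¹-involutive)
  open Solver (freeGroup k)

  cyc-resp : ∀ {w x y : Word k} → x ≈ y → Cyc w x → Cyc w y
  cyc-resp p (e , q) = e , ≈-trans (≈-sym p) q

  cyc-ε : ∀ {w : Word k} → Cyc w ε
  cyc-ε = + 0 , ≈-refl

  -- The exponent moves up by one, with a separate case where it crosses from -1 to 0. `cyc-·`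
  -- iterates such unit shifts in place of an addition law for exponents.
  cyc-·ˡ : ∀ {w x : Word k} → Cyc w x → Cyc w (w · x)
  cyc-·ˡ {w} (+ j , p) = + suc j , ·-congˡ w p
  cyc-·ˡ {w} (-[1+ zero ] , p) = + 0 , ≈-trans (·-congˡ w p) (solve (w ∷ []) (v₀ ⊙ (v₀ ⊖ ⊙ 𝟙)) 𝟙 refl)
  cyc-·ˡ {w} (-[1+ suc j ] , p) = -[1+ j ] ,
    ≈-trans (·-congˡ w p) (solve (w ∷ powℕ (w ⁻¹) (suc j) ∷ []) (v₀ ⊙ (v₀ ⊖ ⊙ v₁)) v₁ refl)

  cyc-⁻¹·ˡ : ∀ {w x : Word k} → Cyc w x → Cyc w (w ⁻¹ · x)
  cyc-⁻¹·ˡ {w} (+ zero , p) = -[1+ 0 ] , ·-congˡ (w ⁻¹) p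
  cyc-⁻¹·ˡ {w} (+ suc j , p) = + j ,
    ≈-trans (·-congˡ (w ⁻¹) p) (solve (w ∷ powℕ w j ∷ []) (v₀ ⊖ ⊙ (v₀ ⊙ v₁)) v₁ refl)
  cyc-⁻¹·ˡ {w} (-[1+ j ] , p) = -[1+ suc j ] , ·-congˡ (w ⁻¹) p

  cyc-· : ∀ {w x y : Word k} → Cyc w x → Cyc w y → Cyc w (x · y)
  cyc-· {w} {x} {y} (e , p) c = cyc-resp (·-congʳ y (≈-sym p)) (go e)
    where
    iter : ∀ u → (∀ {z} → Cyc w z → Cyc w (u · z)) → ∀ j → Cyc w (powℕ u j · y)
    iter u step zero    = c
    iter u step (suc j) = cyc-resp (≈-sym (assoc u _ _)) (step (iter u step j))
    go : ∀ e → Cyc w (pow w e · y)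
    go (+ j)    = iter w cyc-·ˡ j
    go -[1+ j ] = iter (w ⁻¹) cyc-⁻¹·ˡ (suc j)

  cyc-self : ∀ {w : Word k} → Cyc w w
  cyc-self {w} = cyc-resp (identityʳ w) (cyc-·ˡ cyc-ε)

  cyc-powℕ : ∀ {w x : Word k} → Cyc w x → ∀ j → Cyc w (powℕ x j)
  cyc-powℕ c zero    = cyc-ε
  cyc-powℕ c (suc j) = cyc-· c (cyc-powℕ c j)

  cyc-⁻¹ : ∀ {w x : Word k} → Cyc w x → Cyc w (x ⁻¹)
  cyc-⁻¹ {w} {x} (e , p) = cyc-resp (⁻¹-cong (≈-sym p)) (go e)
    where
    iter : ∀ {u} → Cyc w (u ⁻¹) → ∀ j → Cyc w (powℕ u j ⁻¹)
    iter c zero = cyc-ε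
    iter {u} c (suc j) = cyc-resp (≡⇒≈ (sym (⁻¹-++ u (powℕ u j)))) (cyc-· (iter c j) c)
    w⁻¹ : Cyc w (w ⁻¹)
    w⁻¹ = cyc-resp (identityʳ (w ⁻¹)) (cyc-⁻¹·ˡ cyc-ε)
    go : ∀ e → Cyc w (pow w e ⁻¹)
    go (+ j) = iter w⁻¹ j
    go -[1+ j ] = iter {w ⁻¹} (cyc-resp (≈-sym (⁻¹-involutive w)) cyc-self) (suc j)

  cyc-trans : ∀ {w x y : Word k} → Cyc w x → Cyc x y → Cyc w y
  cyc-trans c (+ j , p)      = cyc-resp (≈-sym p) (cyc-powℕ c j)
  cyc-trans c (-[1+ j ] , p) = cyc-resp (≈-sym p) (cyc-powℕ (cyc-⁻¹ c) (suc j))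

  cyc-^ : ∀ {w x : Word k} g → Cyc w x → Cyc (w ^ g) (x ^ g)
  cyc-^ {w} {x} g (e , p) = cyc-resp (·-congʳ g (·-congˡ (g ⁻¹) (≈-sym p))) (go e)
    where
    iter : ∀ {u} → Cyc (w ^ g) (u ^ g) → ∀ j → Cyc (w ^ g) (powℕ u j ^ g)
    iter c zero = cyc-resp (≈-sym (solve (g ∷ []) (𝟙 ^ᵉ v₀) 𝟙 refl)) cyc-ε
    iter {u} c (suc j) = cyc-resp
      (solve (g ∷ u ∷ powℕ u j ∷ []) (v₁ ^ᵉ v₀ ⊙ v₂ ^ᵉ v₀) ((v₁ ⊙ v₂) ^ᵉ v₀) refl)
      (cyc-· c (iter c j))
    go : ∀ e → Cyc (w ^ g) (pow w e ^ g)
    go (+ j)    = iter cyc-self j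
    go -[1+ j ] = iter (cyc-resp (solve (g ∷ w ∷ []) ((v₁ ^ᵉ v₀) ⊖) ((v₁ ⊖) ^ᵉ v₀) refl) (cyc-⁻¹ cyc-self)) (suc j)

  -- Unlike in `HasRoot`, the exponents 1 and -1 are allowed, so `w` may be `x` or `y` itself.
  CommonRoot : Word k → Word k → Set
  CommonRoot x y = ∃[ w ] (Cyc w x × Cyc w y)

  commonRoot-resp : ∀ {x x′ y y′ : Word k} → x ≈ x′ → y ≈ y′ → CommonRoot x y → CommonRoot x′ y′
  commonRoot-resp p q (w , c , d) = w , cyc-resp p c , cyc-resp q d

-- Commuting strings and Euclid's algorithm

++-compare : ∀ {A : Set} (x y : List A) {u v} → x ++ u ≡ y ++ v →
             (∃[ d ] y ≡ x ++ d) ⊎ (∃[ d ] x ≡ y ++ d)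
++-compare [] y p = inj₁ (y , refl)
++-compare (a ∷ x) [] p = inj₂ (a ∷ x , refl)
++-compare (a ∷ x) (b ∷ y) p with ∷-injective p
... | refl , q with ++-compare x y q
...   | inj₁ (d , r) = inj₁ (d , cong (a ∷_) r)
...   | inj₂ (d , r) = inj₂ (d , cong (a ∷_) r)

-- One step of Euclid's algorithm: if `y = x ++ d` commutes with `x`, cancelling a leading `x`
-- leaves the same relation between `x` and `d`.
++-strip : ∀ {A : Set} (x d : List A) → x ++ (x ++ d) ≡ (x ++ d) ++ x → x ++ d ≡ d ++ x
++-strip x d p = ++-cancelˡ x _ _ (trans p (++-assoc x d x))

-- Of two commuting strings one is a prefix of the other, and it can be stripped off. `N` bounds the
-- total length, which falls because the stripped prefix is nonempty.
++-commute⇒commonRoot : ∀ N (x y : Word k) → length x + length y ≤ N → x ++ y ≡ y ++ x → CommonRoot x y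
++-commute⇒commonRoot N [] y b p = y , cyc-ε , cyc-self
++-commute⇒commonRoot N (a ∷ x) [] b p = a ∷ x , cyc-self , cyc-ε
++-commute⇒commonRoot (suc N) x@(a ∷ x₀) y@(c ∷ y₀) (s≤s b) p with ++-compare x y p
... | inj₁ (d , refl) =
  let w , cx , cd = ++-commute⇒commonRoot N x d
        (ℕ.≤-trans (ℕ.≤-reflexive (sym (length-++ x))) (ℕ.≤-trans (ℕ.m≤n+m _ (length x₀)) b)) (++-strip x d p)
  in w , cx , cyc-· cx cd
... | inj₂ (d , refl) =
  let w , cy , cd = ++-commute⇒commonRoot N y d
        (ℕ.≤-pred (ℕ.≤-trans (ℕ.≤-trans (ℕ.≤-reflexive (cong suc (sym (length-++ y))))
          (ℕ.≤-trans (ℕ.m≤n+m _ (length y₀)) (ℕ.≤-reflexive (trans (ℕ.+-suc (length y₀) (length x)) (ℕ.+-comm (suc (length y₀)) (length x)))))) (s≤s b)))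
        (++-strip y d (sym p))
  in w , cyc-· cy cd , cy

-- Cancellation where two words meet

snoc-view : ∀ {A : Set} (a : A) w → ∃[ u ] ∃[ b ] a ∷ w ≡ u ++ [ b ]
snoc-view a [] = [] , a , refl
snoc-view a (c ∷ w) with snoc-view c w
... | u , b , p = a ∷ u , b , cong (a ∷_) p

-- Distinct first and last letters occupy two positions, so the last one survives removal of the
-- first. This peels a conjugating letter off both ends of a word.
∷≡∷ʳ-split : ∀ {A : Set} {a b : A} {w u} → a ≢ b → a ∷ w ≡ u ++ [ b ] → ∃[ v ] w ≡ v ++ [ b ]
∷≡∷ʳ-split {u = []}    n refl = contradiction refl n
∷≡∷ʳ-split {u = _ ∷ u} n p    = u , proj₂ (∷-injective p)

reduced-joint : ∀ {u : Word k} {u₀ v′ x y} → u ≡ u₀ ++ [ x ] →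
                Reduced u → Reduced (y ∷ v′) → NoCancel x y → Reduced (u ++ y ∷ v′)
reduced-joint {u₀ = u₀} refl = reduced-++ {u = u₀}

-- A reduced word is shortest in its class. If one product is reduced while the other loses two
-- letters at the joint, the two cannot be equal.
cancelling-joint : ∀ {u : Word k} {u₀ v′ x y} → u ≡ u₀ ++ [ x ] → y ≡ invL x →
                   Reduced ((y ∷ v′) ++ u) → ¬ (u · (y ∷ v′) ≈ (y ∷ v′) · u)
cancelling-joint {u₀ = u₀} {v′} {x} {y} refl refl r p = ℕ.<-irrefl refl (begin-strict
  length (u₀ ++ v′)                     ≡⟨ length-++ u₀ ⟩
  length u₀ + length v′                 ≡⟨ ℕ.+-comm (length u₀) _ ⟩
  length v′ + length u₀                 <⟨ ℕ.+-mono-<-≤ (ℕ.n<1+n _) (ℕ.≤-trans (ℕ.m≤m+n _ 1) (ℕ.≤-reflexive (sym (length-++ u₀)))) ⟩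
  suc (length v′) + length (u₀ ++ [ x ]) ≡⟨ length-++ (y ∷ v′) ⟨
  length ((y ∷ v′) ++ u₀ ++ [ x ])      ≤⟨ reduced-shortest r (≈-trans (≈-sym p) (≈-trans (≡⇒≈ (++-assoc u₀ [ x ] _)) (≈-cancel u₀ x v′))) ⟩
  length (u₀ ++ v′)                     ∎)
  where open ℕ.≤-Reasoning

module _ {k : ℕ} where
  open Solver (freeGroup k)
  open GroupProperties (freeGroup k) using (⁻¹-involutive)
  open Group (freeGroup k) using (∙-cong)

  ^-commute⁻ : ∀ (x y g : Word k) → x ^ g · y ^ g ≈ y ^ g · x ^ g → x · y ≈ y · x
  ^-commute⁻ x y g p =
    ≈-trans (solve (x ∷ y ∷ g ∷ []) (v₀ ⊙ v₁) ((v₀ ^ᵉ v₂ ⊙ v₁ ^ᵉ v₂) ^ᵉ (v₂ ⊖)) refl)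
    (≈-trans (·-congʳ (g ⁻¹) (·-congˡ (g ⁻¹ ⁻¹) p))
             (solve (x ∷ y ∷ g ∷ []) ((v₁ ^ᵉ v₂ ⊙ v₀ ^ᵉ v₂) ^ᵉ (v₂ ⊖)) (v₁ ⊙ v₀) refl))

  ⁻¹-commute : ∀ {x y : Word k} → x · y ≈ y · x → x · y ⁻¹ ≈ y ⁻¹ · x
  ⁻¹-commute {x} {y} p =
    ≈-trans (solve (x ∷ y ∷ []) (v₀ ⊙ v₁ ⊖) (v₁ ⊖ ⊙ (v₁ ⊙ v₀) ⊙ v₁ ⊖) refl)
    (≈-trans (·-congʳ (y ⁻¹) (·-congˡ (y ⁻¹) (≈-sym p)))
             (solve (x ∷ y ∷ []) (v₁ ⊖ ⊙ (v₀ ⊙ v₁) ⊙ v₁ ⊖) (v₁ ⊖ ⊙ v₀) refl))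

  -- Euclid's algorithm applies once neither xy nor yx has a cancellation.  If both cancel, then
  -- either x and y share a conjugating letter, or x y⁻¹ and y⁻¹ x have no cancellation.
  commute⇒commonRoot : ∀ N (x y : Word k) → length x ≤ N → x · y ≈ y · x → CommonRoot x y
  reduced-commute⇒commonRoot : ∀ N (x y : Word k) → length x ≤ N → Reduced x → Reduced y →
                               x · y ≈ y · x → CommonRoot x y

  commute⇒commonRoot N x y b p = commonRoot-resp (nf-≈ x) (nf-≈ y)
    (reduced-commute⇒commonRoot N (nf x) (nf y) (ℕ.≤-trans (nf-length x) b) (nf-reduced x) (nf-reduced y)
      (≈-trans (∙-cong (nf-≈ x) (nf-≈ y)) (≈-trans p (∙-cong (≈-sym (nf-≈ y)) (≈-sym (nf-≈ x))))))

  reduced-commute⇒commonRoot N [] y b rx ry p = y , cyc-ε , cyc-self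
  reduced-commute⇒commonRoot N x [] b rx ry p = x , cyc-self , cyc-ε
  reduced-commute⇒commonRoot (suc N) x@(a ∷ x₀) y@(c ∷ y₀) (s≤s b) rx ry p
    with snoc-view a x₀ | snoc-view c y₀
  ... | x₁ , a′ , ex | y₁ , c′ , ey with c ≟L invL a′ | a ≟L invL c′
  -- Both products are reduced, so equality in the group is equality of strings.
  ... | no xy | no yx = ++-commute⇒commonRoot _ x y ℕ.≤-refl
    (reduced-≈⇒≡ (reduced-joint {u₀ = x₁} ex rx ry xy) (reduced-joint {u₀ = y₁} ey ry rx yx) p)
  ... | yes xy | no yx = contradiction p
    (cancelling-joint {u₀ = x₁} ex xy (reduced-joint {u₀ = y₁} ey ry rx yx))
  ... | no xy | yes yx = contradiction (≈-sym p)
    (cancelling-joint {u₀ = y₁} ey yx (reduced-joint {u₀ = x₁} ex rx ry xy))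
  -- Both joints cancel: `y` begins with the inverse of the last letter `a′` of `x`, and `x` with
  -- the inverse of the last letter `c′` of `y`. It remains to compare `a′` with `c′`.
  ... | yes refl | yes refl with invL c′ ≟L invL a′
  ...   | yes q = conj-case (∷≡∷ʳ-split (λ r → invL-irrefl a′ (sym (trans (sym q) r))) ex)
                           (∷≡∷ʳ-split (λ r → invL-irrefl c′ (sym (trans q r))) ey)
    where
    c′≡a′ : c′ ≡ a′
    c′≡a′ = trans (sym (invL-involutive c′)) (trans (cong invL q) (invL-involutive a′))
    conj-case : (∃[ u ] x₀ ≡ u ++ [ a′ ]) → (∃[ v ] y₀ ≡ v ++ [ c′ ]) → CommonRoot x y
    conj-case (u , refl) (v , refl) =
      -- `u` is `x` without its two end letters. The recursion re-enters through
      -- `commute⇒commonRoot`, which normalises again, so `u` and `v` come without reducedness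
      -- proofs.
      let w , cu , cv = commute⇒commonRoot N u v
            (ℕ.≤-trans (ℕ.≤-trans (ℕ.m≤m+n _ 1) (ℕ.≤-reflexive (sym (length-++ u)))) b)
            (^-commute⁻ u v [ a′ ] (subst₂ (λ s t → s · t ≈ t · s) x≡ y≡ p))
      in commonRoot-resp (≡⇒≈ (sym x≡)) (≡⇒≈ (sym y≡)) (w ^ [ a′ ] , cyc-^ [ a′ ] cu , cyc-^ [ a′ ] cv)
      where
      x≡ : invL c′ ∷ u ++ [ a′ ] ≡ u ^ [ a′ ]
      x≡ = cong (λ s → s ∷ u ++ [ a′ ]) q
      y≡ : invL a′ ∷ v ++ [ c′ ] ≡ v ^ [ a′ ]
      y≡ = cong (λ s → invL a′ ∷ v ++ [ s ]) c′≡a′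
  ...   | no q = commonRoot-resp ≈-refl (⁻¹-involutive y) (w , cx , cyc-⁻¹ cy)
    where
    y⁻¹ : Word k
    y⁻¹ = (invL c′ ∷ y₁ ⁻¹)
    y⁻¹-head : y ⁻¹ ≡ y⁻¹
    y⁻¹-head = trans (cong _⁻¹ ey) (⁻¹-++ y₁ [ c′ ])
    ry⁻¹ : Reduced (y ⁻¹)
    ry⁻¹ = reduced-⁻¹ ry
    xy⁻¹ : x ++ y ⁻¹ ≡ y ⁻¹ ++ x
    -- At either joint a cancellation would force `invL c′ ≡ invL a′`: `y ⁻¹` begins with `invL c′`
    -- and ends in `a′`, while `x` begins with `invL c′` and ends in `a′`.
    xy⁻¹ = reduced-≈⇒≡
      (subst (λ u → Reduced (x ++ u)) (sym y⁻¹-head)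
        (reduced-joint {u₀ = x₁} ex rx (subst Reduced y⁻¹-head ry⁻¹) q))
      (reduced-joint {u₀ = y₀ ⁻¹} (⁻¹-∷ c y₀) ry⁻¹ rx
        (λ r → q (trans r (invL-involutive (invL a′)))))
      (⁻¹-commute {x} {y} p)
    root : CommonRoot x (y ⁻¹)
    root = ++-commute⇒commonRoot _ x (y ⁻¹) ℕ.≤-refl xy⁻¹
    w = proj₁ root
    cx = proj₁ (proj₂ root)
    cy = proj₂ (proj₂ root)

module _ {k : ℕ} where
  open Group (freeGroup k) using (identityʳ)
  open GroupProperties (freeGroup k) using (⁻¹-involutive)

  -- The exponent of `A` over `w` must be 1 or -1, so `w` is `A` or its inverse.
  noRoot-generates : ∀ {A w : Word k} → ¬ HasRoot A → Cyc w A → Cyc A w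
  noRoot-generates {A} {w} n (e , p) with e ℤ.≟ + 1 | e ℤ.≟ ℤ.- (+ 1)
  ... | yes refl | _        = cyc-resp (≈-trans p (identityʳ w)) cyc-self
  ... | no _     | yes refl = cyc-resp
    (≈-trans (⁻¹-cong-≈ (≈-trans p (identityʳ (w ⁻¹)))) (⁻¹-involutive w)) (cyc-⁻¹ cyc-self)
  ... | no e≢1   | no e≢-1  = contradiction (w , e , e≢1 , e≢-1 , p) n

  -- Commuting elements are powers of a common `w`, and a rootless `A` already generates the powers
  -- of `w`.
  centralizer-cyclic : ∀ {A x : Word k} → ¬ HasRoot A → A · x ≈ x · A → Cyc A x
  centralizer-cyclic {A} {x} n p =
    let w , cA , cx = commute⇒commonRoot _ A x ℕ.≤-refl p
    in cyc-trans (noRoot-generates n cA) cx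

-- Exponent sums

ℤ-group : Group _ _
ℤ-group = AbelianGroup.group ℤ.+-0-abelianGroup

module _ {k : ℕ} (x : Fin k) where
  open Lift ℤ-group

  indicator : Fin k → ℤ
  indicator y with y Fin.≟ x
  ... | yes _ = + 1
  ... | no  _ = + 0

  indicator-≡ : indicator x ≡ + 1
  indicator-≡ with x Fin.≟ x
  ... | yes _ = refl
  ... | no  p = contradiction refl p

  indicator-≢ : ∀ {y} → y ≢ x → indicator y ≡ + 0
  indicator-≢ {y} n with y Fin.≟ x
  ... | yes p = contradiction p n
  ... | no  _ = refl

  exponent : Word k → ℤ
  exponent = lift indicator

  exponent-gen : exponent (gen x) ≡ + 1
  exponent-gen = cong (ℤ._+ + 0) indicator-≡

  exponent-gen-≢ : ∀ {y} → y ≢ x → exponent (gen y) ≡ + 0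
  exponent-gen-≢ n = cong (ℤ._+ + 0) (indicator-≢ n)

  exponent-powℕ : ∀ w j → exponent (powℕ w j) ≡ + j ℤ.* exponent w
  exponent-powℕ w zero = sym (ℤ.*-zeroˡ (exponent w))
  exponent-powℕ w (suc j) = trans (lift-· indicator w (powℕ w j))
    (trans (cong (λ i → exponent w ℤ.+ i) (exponent-powℕ w j)) (sym (ℤ.suc-* (+ j) (exponent w))))

  -- A homomorphism to an abelian group is constant on conjugacy classes.
  exponent-^ : ∀ w g → exponent (w ^ g) ≡ exponent w
  exponent-^ w g = begin
    exponent (g ⁻¹ · w · g)                        ≡⟨ lift-· indicator (g ⁻¹ · w) g ⟩
    exponent (g ⁻¹ · w) ℤ.+ exponent g             ≡⟨ cong (ℤ._+ exponent g) (lift-· indicator (g ⁻¹) w) ⟩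
    exponent (g ⁻¹) ℤ.+ exponent w ℤ.+ exponent g  ≡⟨ cong (λ i → i ℤ.+ exponent w ℤ.+ exponent g) (lift-⁻¹ indicator g) ⟩
    ℤ.- exponent g ℤ.+ exponent w ℤ.+ exponent g   ≡⟨ cong (ℤ._+ exponent g) (ℤ.+-comm (ℤ.- exponent g) (exponent w)) ⟩
    exponent w ℤ.+ ℤ.- exponent g ℤ.+ exponent g   ≡⟨ GroupProperties.//-rightDividesˡ ℤ-group (exponent g) (exponent w) ⟩
    exponent w                                     ∎
    where open ≡-Reasoning

  -- The exponent sum of `x` in a power is a multiple of the exponent, and here it is 1; so the
  -- exponent has absolute value 1.
  gen-noRoot : ¬ HasRoot (gen x)
  gen-noRoot (w , e , e≢1 , e≢-1 , p) = impossible e e≢1 e≢-1 p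
    where
    unit : ∀ u j → gen x ≈ powℕ u j → j ≡ 1
    unit u j q = ℕ.m*n≡1⇒m≡1 j ℤ.∣ exponent u ∣ (begin
      j ℕ.* ℤ.∣ exponent u ∣       ≡⟨ ℤ.abs-* (+ j) (exponent u) ⟨
      ℤ.∣ + j ℤ.* exponent u ∣     ≡⟨ cong ℤ.∣_∣ (exponent-powℕ u j) ⟨
      ℤ.∣ exponent (powℕ u j) ∣    ≡⟨ cong ℤ.∣_∣ (lift-cong indicator q) ⟨
      ℤ.∣ exponent (gen x) ∣       ≡⟨ cong ℤ.∣_∣ exponent-gen ⟩
      1                            ∎)
      where open ≡-Reasoning
    impossible : ∀ e → ¬ e ≡ + 1 → ¬ e ≡ ℤ.- (+ 1) → ¬ gen x ≈ pow w e
    impossible (+ j)    n _ q = n (cong +_ (unit w j q))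
    impossible -[1+ j ] _ n q = n (cong (λ i → -[1+ i ]) (ℕ.suc-injective (unit (w ⁻¹) (suc j) q)))

-- Hurwitz moves on the image of a direct sum

pairGroup : ℕ → ℕ → Group _ _
pairGroup k l = record
  { Carrier = Pair k l ; _≈_ = _≈₂_ ; _∙_ = _·₂_ ; ε = ε , ε ; _⁻¹ = _⁻¹₂
  ; isGroup = Group.isGroup (DirectProduct.group (freeGroup k) (freeGroup l)) }

infix 8 _^₂_
_^₂_ : Pair k l → Pair k l → Pair k l
x ^₂ g = g ⁻¹₂ ·₂ x ·₂ g

^₂-cong : ∀ {x y : Pair k l} g → x ≈₂ y → x ^₂ g ≈₂ y ^₂ g
^₂-cong {k} {l} g p = ∙-congʳ {g} (∙-congˡ {g ⁻¹₂} p)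
  where open Group (pairGroup k l)

prodL : List (Pair k l) → Pair k l
prodL = foldr _·₂_ (ε , ε)

hurwitz-refl : ∀ {s} → Hurwitz s s
hurwitz-refl = h-eq (Pointwise.refl (≈-refl , ≈-refl))

hurwitz-∷ : ∀ x {s t} → Hurwitz s t → Hurwitz (x ∷ s) (x ∷ t)
hurwitz-∷ x (h-eq p) = h-eq ((≈-refl , ≈-refl) ∷ p)
hurwitz-∷ x (h-σ pre f g post) = h-σ (x ∷ pre) f g post
hurwitz-∷ x (h-σ⁻¹ pre f g post) = h-σ⁻¹ (x ∷ pre) f g post
hurwitz-∷ x (h-sym p) = h-sym (hurwitz-∷ x p)
hurwitz-∷ x (h-trans p q) = h-trans (hurwitz-∷ x p) (hurwitz-∷ x q)

-- A move, or its inverse, only conjugates one entry by a neighbour or the neighbour's inverse. Both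
-- directions are proved together because `h-sym` exchanges them.
hurwitz-All : {S : G → Set} → (∀ {x y} → x ≈₂ y → S x → S y) →
              (∀ {x y} → S x → S y → S (x ^₂ y)) → (∀ {x y} → S x → S y → S (x ^₂ (y ⁻¹₂))) →
              ∀ {s t} → Hurwitz s t → (All S s → All S t) × (All S t → All S s)
hurwitz-All {S} resp conj conj⁻¹ = go
  where
  open Solver (pairGroup 2 2)
  pw : ∀ {s t} → Pointwise _≈₂_ s t → All S s → All S t
  pw [] [] = []
  pw (p ∷ ps) (x ∷ xs) = resp p x ∷ pw ps xs
  go : ∀ {s t} → Hurwitz s t → (All S s → All S t) × (All S t → All S s)
  go (h-eq p) = pw p , pw (Pointwise.symmetric (λ (q , r) → ≈-sym q , ≈-sym r) p)
  go (h-σ pre f g post) =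
    (λ a → let p , q = All.++⁻ pre a in All.++⁺ p (case q of λ where
      (x ∷ y ∷ z) → y ∷ conj x y ∷ z)) ,
    (λ a → let p , q = All.++⁻ pre a in All.++⁺ p (case q of λ where
      (y ∷ x ∷ z) → resp (solve (f ∷ g ∷ []) ((v₀ ^ᵉ v₁) ^ᵉ (v₁ ⊖)) v₀ refl) (conj⁻¹ x y) ∷ y ∷ z))
  go (h-σ⁻¹ pre f g post) =
    (λ a → let p , q = All.++⁻ pre a in All.++⁺ p (case q of λ where
      (x ∷ y ∷ z) → resp (solve (f ∷ g ∷ []) (v₁ ^ᵉ (v₀ ⊖)) (v₀ ⊙ v₁ ⊙ v₀ ⊖) refl) (conj⁻¹ y x) ∷ x ∷ z)) ,
    (λ a → let p , q = All.++⁻ pre a in All.++⁺ p (case q of λ where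
      (y ∷ x ∷ z) → x ∷ resp (solve (f ∷ g ∷ []) ((v₀ ⊙ v₁ ⊙ v₀ ⊖) ^ᵉ v₀) v₁ refl) (conj y x) ∷ z))
  go (h-sym p) = let q , r = go p in r , q
  go (h-trans p q) = let p₁ , p₂ = go p ; q₁ , q₂ = go q in q₁ ∘ p₁ , p₂ ∘ q₂

module Image {k l} (i : Pair k l → G) (isHom : IsInjectiveHom i) where
  open IsInjectiveHom isHom
  private
    module 𝔾 = Group (pairGroup 2 2)
    module 𝕂 = Group (pairGroup k l)
  open Solver (pairGroup k l)

  hom-⁻¹ : ∀ x → i (x ⁻¹₂) ≈₂ (i x) ⁻¹₂
  hom-⁻¹ x = inverseˡ-unique (i (x ⁻¹₂)) (i x)
    (𝔾.trans (𝔾.sym (hom (x ⁻¹₂) x)) (𝔾.trans (resp (𝕂.inverseˡ x)) hom-ε))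
    where
    open GroupProperties (pairGroup 2 2) using (inverseˡ-unique; identityˡ-unique)
    hom-ε : i (ε , ε) ≈₂ (ε , ε)
    hom-ε = identityˡ-unique (i (ε , ε)) (i (ε , ε)) (𝔾.sym (hom (ε , ε) (ε , ε)))

  hom-^ : ∀ x g → i (x ^₂ g) ≈₂ i x ^₂ i g
  hom-^ x g = 𝔾.trans (hom (g ⁻¹₂ ·₂ x) g)
    (𝔾.∙-congʳ (𝔾.trans (hom (g ⁻¹₂) x) (𝔾.∙-congʳ (hom-⁻¹ g))))

  hom-^⁻¹ : ∀ x g → i (x ^₂ (g ⁻¹₂)) ≈₂ i x ^₂ (i g ⁻¹₂)
  hom-^⁻¹ x g = 𝔾.trans (hom-^ x (g ⁻¹₂)) (𝔾.∙-cong (𝔾.∙-congʳ (𝔾.⁻¹-cong (hom-⁻¹ g))) (hom-⁻¹ g))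

  infix 4 _~_
  -- Moves commute with the homomorphism `i`, so equivalences of image tuples can be computed on
  -- preimages.
  _~_ : List (Pair k l) → List (Pair k l) → Set
  s ~ t = Hurwitz (map i s) (map i t)

  ~-++ˡ : ∀ u {s t} → s ~ t → u ++ s ~ u ++ t
  ~-++ˡ []      p = p
  ~-++ˡ (x ∷ u) p = hurwitz-∷ (i x) (~-++ˡ u p)

  ~-head : ∀ {x y} s → x ≈₂ y → x ∷ s ~ y ∷ s
  ~-head s p = h-eq (resp p ∷ Pointwise.refl 𝔾.refl)

  ~-map : ∀ {A : Set} {f g : A → Pair k l} → (∀ x → f x ≈₂ g x) → ∀ xs post → map f xs ++ post ~ map g xs ++ post
  ~-map p [] post = hurwitz-refl
  ~-map {g = g} p (x ∷ xs) post = h-trans (~-head _ (p x)) (hurwitz-∷ (i (g x)) (~-map p xs post))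

  ~-σ : ∀ f g post → f ∷ g ∷ post ~ g ∷ f ^₂ g ∷ post
  ~-σ f g post = h-trans (h-σ [] (i f) (i g) (map i post))
    (h-eq (𝔾.refl ∷ 𝔾.sym (hom-^ f g) ∷ Pointwise.refl 𝔾.refl))

  ~-σ⁻¹ : ∀ f g post → f ∷ g ∷ post ~ (f ·₂ g ·₂ f ⁻¹₂) ∷ f ∷ post
  ~-σ⁻¹ f g post = h-trans (h-σ⁻¹ [] (i f) (i g) (map i post))
    (h-eq (𝔾.sym (𝔾.trans (hom (f ·₂ g) (f ⁻¹₂)) (𝔾.∙-cong (hom f g) (hom-⁻¹ f))) ∷ 𝔾.refl ∷ Pointwise.refl 𝔾.refl))

  -- Moving left by σ, `g` stays unchanged and conjugates every entry it crosses.
  block-σ : ∀ B g post → B ++ g ∷ post ~ g ∷ map (_^₂ g) B ++ post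
  block-σ []      g post = hurwitz-refl
  block-σ (f ∷ B) g post = h-trans (hurwitz-∷ (i f) (block-σ B g post)) (~-σ f g _)

  -- Moving left by σ⁻¹, `g` leaves the entries unchanged and is itself conjugated by each in turn,
  -- hence in total by their product.
  block-σ⁻¹ : ∀ B g post → B ++ g ∷ post ~ (prodL B ·₂ g ·₂ prodL B ⁻¹₂) ∷ B ++ post
  block-σ⁻¹ []      g post = ~-head post (solve (g ∷ []) v₀ (𝟙 ⊙ v₀ ⊙ 𝟙 ⊖) refl)
  block-σ⁻¹ (f ∷ B) g post = h-trans (hurwitz-∷ (i f) (block-σ⁻¹ B g post)) (h-trans (~-σ⁻¹ f _ _)
    (~-head _ (solve (f ∷ prodL B ∷ g ∷ []) (v₀ ⊙ (v₁ ⊙ v₂ ⊙ v₁ ⊖) ⊙ v₀ ⊖) (v₀ ⊙ v₁ ⊙ v₂ ⊙ (v₀ ⊙ v₁) ⊖) refl)))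

  module _ {B : List (Pair k l)} (B≈ε : prodL B ≈₂ (ε , ε)) where
    block-pass : ∀ g post → B ++ g ∷ post ~ g ∷ B ++ post
    block-pass g post = h-trans (block-σ⁻¹ B g post) (~-head _
      (𝕂.trans (𝕂.∙-cong (𝕂.∙-congʳ B≈ε) (𝕂.⁻¹-cong B≈ε)) (solve (g ∷ []) (𝟙 ⊙ v₀ ⊙ 𝟙 ⊖) v₀ refl)))

    block-swap : ∀ C post → B ++ C ++ post ~ C ++ B ++ post
    block-swap []      post = hurwitz-refl
    block-swap (g ∷ C) post = h-trans (block-pass g _) (hurwitz-∷ (i g) (block-swap C post))

  prodL-^ : ∀ B g → prodL (map (_^₂ g) B) ≈₂ prodL B ^₂ g
  prodL-^ []      g = solve (g ∷ []) 𝟙 (𝟙 ^ᵉ v₀) refl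
  prodL-^ (f ∷ B) g = 𝕂.trans (𝕂.∙-congˡ (prodL-^ B g))
    (solve (f ∷ prodL B ∷ g ∷ []) (v₀ ^ᵉ v₂ ⊙ v₁ ^ᵉ v₂) ((v₀ ⊙ v₁) ^ᵉ v₂) refl)

  prodL-^-ε : ∀ {B} → prodL B ≈₂ (ε , ε) → ∀ g → prodL (map (_^₂ g) B) ≈₂ (ε , ε)
  prodL-^-ε {B} p g = 𝕂.trans (prodL-^ B g)
    (𝕂.trans (^₂-cong g p) (solve (g ∷ []) (𝟙 ^ᵉ v₀) 𝟙 refl))

  -- Passing a neighbour g to the left by σ conjugates a block by g; a block with trivial product
  -- can return by σ⁻¹ moves that change nothing.
  block-^ : ∀ {B C g} → prodL B ≈₂ (ε , ε) → g ∈ C → ∀ post → C ++ B ++ post ~ C ++ map (_^₂ g) B ++ post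
  block-^ {B} {c ∷ C} B≈ε (there p) post = hurwitz-∷ (i c) (block-^ {B} {C} B≈ε p post)
  block-^ {B} {g ∷ C} B≈ε (here refl) post =
    h-trans (hurwitz-∷ (i g) (h-sym (block-swap B≈ε C post)))
    (h-trans (h-sym (block-pass B≈ε g (C ++ post)))
    (h-trans (block-σ B g (C ++ post)) (hurwitz-∷ (i g) (block-swap (prodL-^-ε {B} B≈ε g) C post))))

  inl : Word k → Pair k l
  inl r = r , ε

  cancelPair : Word k → Word l → List (Pair k l)
  cancelPair c d = (c ⁻¹ , d ⁻¹) ∷ (c , d) ∷ []

  prodL-cancelPair : ∀ c d → prodL (cancelPair c d) ≈₂ (ε , ε)
  prodL-cancelPair c d = solve ((c , d) ∷ []) (v₀ ⊖ ⊙ (v₀ ⊙ 𝟙)) 𝟙 refl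

  prodL-inl : ∀ R → prodL (map inl R) ≡ inl (foldr _·_ ε R)
  prodL-inl []      = refl
  prodL-inl (r ∷ R) = cong (inl r ·₂_) (prodL-inl R)

  -- The second coordinate of the conjugator only meets `ε`, so a middle entry acts on the first
  -- block through its first coordinate alone.
  inl-^ : ∀ g q r → inl r ^₂ (g , q) ≈₂ inl (r ^ g)
  inl-^ g q r = ≈-refl , Solver.solve (freeGroup l) (q ∷ []) (𝟙 ^ᵉ v₀) 𝟙 refl

  -- Conjugating the first block by elements of the middle block makes every conjugate of an entry r
  -- available for conjugating the last block.
  module ThreeBlocks (B : List (Pair k l)) (B≈ε : prodL B ≈₂ (ε , ε))
                     (covers : ∀ j → ∃[ q ] (gen j , q) ∈ B) (d : Word l) where
    private
      module F = Group (freeGroup k)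
      module FS = Solver (freeGroup k)

    blocks : List (Word k) → Word k → List (Pair k l)
    blocks R c = map inl R ++ B ++ cancelPair c d

    TrivialProduct : List (Word k) → Set
    TrivialProduct R = foldr _·_ ε R ≈ ε

    inl-trivial : ∀ R → TrivialProduct R → prodL (map inl R) ≈₂ (ε , ε)
    inl-trivial R p = 𝕂.trans (𝕂.reflexive (prodL-inl R)) (p , ≈-refl)

    trivialProduct-^ : ∀ R g → TrivialProduct R → TrivialProduct (map (_^ g) R)
    trivialProduct-^ R g p = F.trans (F.sym (go R))
      (F.trans (F.∙-congʳ {g} (F.∙-congˡ {g ⁻¹} p)) (FS.solve (g ∷ []) (𝟙 ^ᵉ v₀) 𝟙 refl))
      where
      go : ∀ R → foldr _·_ ε R ^ g ≈ foldr _·_ ε (map (_^ g) R)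
      go []      = FS.solve (g ∷ []) (𝟙 ^ᵉ v₀) 𝟙 refl
      go (r ∷ R) = F.trans (FS.solve (r ∷ foldr _·_ ε R ∷ g ∷ []) ((v₀ ⊙ v₁) ^ᵉ v₂) (v₀ ^ᵉ v₂ ⊙ v₁ ^ᵉ v₂) refl)
        (F.∙-congˡ {r ^ g} (go R))

    blocks-cong : ∀ R {c c′} → c ≈ c′ → blocks R c ~ blocks R c′
    blocks-cong R p = ~-++ˡ (map inl R) (~-++ˡ B
      (h-eq (resp (F.⁻¹-cong p , ≈-refl) ∷ resp (p , ≈-refl) ∷ [])))

    -- Successive conjugations agree with a single one only up to `_≈_`, so fusing the maps is
    -- itself an equivalence of tuples.
    blocks-cong-map : ∀ {f g : Word k → Word k} → (∀ r → f r ≈ g r) → ∀ R c → blocks (map f R) c ~ blocks (map g R) c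
    blocks-cong-map {f} {g} p R c = subst₂ _~_ (cong (_++ _) (map-∘ R)) (cong (_++ _) (map-∘ R))
      (~-map (λ r → p r , ≈-refl) R (B ++ cancelPair c d))

    blocks-map-id : ∀ {f : Word k → Word k} → (∀ r → f r ≈ r) → ∀ R c → blocks (map f R) c ~ blocks R c
    blocks-map-id {f} p R c = subst (λ S → blocks (map f R) c ~ blocks S c) (map-id R) (blocks-cong-map p R c)

    blocks-map-∘ : ∀ {f g h : Word k → Word k} → (∀ r → g (f r) ≈ h r) →
                   ∀ R c → blocks (map g (map f R)) c ~ blocks (map h R) c
    blocks-map-∘ {h = h} p R c = subst (λ S → blocks S c ~ blocks (map h R) c) (map-∘ R) (blocks-cong-map p R c)

    -- `block-^` needs the conjugating block on the left, so the first two blocks are exchanged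
    -- before it and exchanged back afterwards.
    blocks-^gen : ∀ R → TrivialProduct R → ∀ j c → blocks R c ~ blocks (map (_^ gen j) R) c
    blocks-^gen R p j c =
      let q , m = covers j
          C = cancelPair c d
      in h-trans (block-swap (inl-trivial R p) B C)
        (h-trans (block-^ {map inl R} {B} (inl-trivial R p) m C)
        (h-trans (~-++ˡ B (subst₂ _~_ (cong (_++ C) (map-∘ R)) (cong (_++ C) (map-∘ R)) (~-map (inl-^ (gen j) q) R C)))
        (h-sym (block-swap (inl-trivial (map (_^ gen j) R) (trivialProduct-^ R (gen j) p)) B C))))

    blocks-^ : ∀ R → TrivialProduct R → ∀ w c → blocks R c ~ blocks (map (_^ w) R) c
    blocks-^ R p [] c = h-sym (blocks-map-id (λ r → FS.solve (r ∷ []) (v₀ ^ᵉ 𝟙) v₀ refl) R c)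
    blocks-^ R p ((j , false) ∷ w) c = h-trans (blocks-^gen R p j c)
      (h-trans (blocks-^ (map (_^ z) R) (trivialProduct-^ R z p) w c)
      (blocks-map-∘ {_^ z} {_^ w} {_^ (z · w)}
        (λ r → FS.solve (r ∷ z ∷ w ∷ []) ((v₀ ^ᵉ v₁) ^ᵉ v₂) (v₀ ^ᵉ (v₁ ⊙ v₂)) refl) R c))
      where z = gen j
    blocks-^ R p ((j , true) ∷ w) c =
      -- For an inverse letter, the move for `z` takes `R′` to `R`; it is read backwards.
      h-trans (h-sym (h-trans (blocks-^gen R′ p′ j c)
        (h-trans (blocks-map-∘ {_^ (z ⁻¹)} {_^ z} {λ r → r} (λ r → FS.solve (r ∷ z ∷ []) ((v₀ ^ᵉ (v₁ ⊖)) ^ᵉ v₁) v₀ refl) R c)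
          (blocks-map-id (λ r → ≈-refl) R c))))
      (h-trans (blocks-^ R′ p′ w c)
      (blocks-map-∘ {_^ (z ⁻¹)} {_^ w} {_^ (z ⁻¹ · w)}
        (λ r → FS.solve (r ∷ z ∷ w ∷ []) ((v₀ ^ᵉ (v₁ ⊖)) ^ᵉ v₂) (v₀ ^ᵉ (v₁ ⊖ ⊙ v₂)) refl) R c))
      where
      z = gen j
      R′ = map (_^ (z ⁻¹)) R
      p′ : TrivialProduct R′
      p′ = trivialProduct-^ R (z ⁻¹) p

    -- The last block also has trivial product, so it can be brought next to the first and
    -- conjugated by `(r , ε)`, which leaves `d` unchanged.
    blocks-∈ : ∀ {R r} → r ∈ R → ∀ c → blocks R c ~ blocks R (c ^ r)
    blocks-∈ {R} {r} m c = h-trans (~-++ˡ (map inl R) (h-sym (block-swap C≈ε B [])))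
      (h-trans (block-^ {C} {map inl R} C≈ε (∈-map⁺ inl m) (B ++ []))
      (h-trans (~-++ˡ (map inl R) (block-swap (prodL-^-ε {C} C≈ε (inl r)) B []))
      (~-++ˡ (map inl R) (~-++ˡ B (h-eq
        (resp (FS.solve (c ∷ r ∷ []) ((v₀ ⊖) ^ᵉ v₁) ((v₀ ^ᵉ v₁) ⊖) refl , unchanged (d ⁻¹)) ∷ resp (≈-refl , unchanged d) ∷ []))))))
      where
      C = cancelPair c d
      C≈ε = prodL-cancelPair c d
      unchanged : ∀ x → x ^ ε ≈ x
      unchanged x = Solver.solve (freeGroup l) (x ∷ []) (v₀ ^ᵉ 𝟙) v₀ refl

    -- The first block is conjugated by `w` only temporarily: meanwhile `r ^ w` is an entry and acts
    -- on the last block, and then the conjugation is undone.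
    blocks-∈-^ : ∀ {R r} → TrivialProduct R → r ∈ R → ∀ w c → blocks R c ~ blocks R (c ^ (r ^ w))
    blocks-∈-^ {R} p m w c = h-trans (blocks-^ R p w c)
      (h-trans (blocks-∈ (∈-map⁺ (_^ w) m) c) (h-sym (blocks-^ R p w _)))

    -- The statement is about u ^ g rather than u so that closure under conjugation is immediate.
    blocks-normalClosure : ∀ {m R} {V : Vec (Word k) m} → TrivialProduct R → (∀ j → lookup V j ∈ R) →
      ∀ {u} → InNormalClosure V u → ∀ g c → blocks R c ~ blocks R (c ^ (u ^ g))
    blocks-normalClosure {R = R} {V} p V⊆R = go
      where
      go : ∀ {u} → InNormalClosure V u → ∀ g c → blocks R c ~ blocks R (c ^ (u ^ g))
      go (nc-gen j) g c = blocks-∈-^ p (V⊆R j) g c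
      go nc-one g c = blocks-cong R (FS.solve (c ∷ g ∷ []) v₀ (v₀ ^ᵉ (𝟙 ^ᵉ v₁)) refl)
      go (nc-mul {u} {v} x y) g c = h-trans (go x g c) (h-trans (go y g _)
        (blocks-cong R (FS.solve (c ∷ g ∷ u ∷ v ∷ []) ((v₀ ^ᵉ (v₂ ^ᵉ v₁)) ^ᵉ (v₃ ^ᵉ v₁)) (v₀ ^ᵉ ((v₂ ⊙ v₃) ^ᵉ v₁)) refl)))
      -- Starting from the tuple already conjugated by the inverse, the equivalence for `u` leads
      -- back to `c`.
      go (nc-inv {u} x) g c = h-sym (h-trans (go x g _)
        (blocks-cong R (FS.solve (c ∷ g ∷ u ∷ []) ((v₀ ^ᵉ ((v₂ ⊖) ^ᵉ v₁)) ^ᵉ (v₂ ^ᵉ v₁)) v₀ refl)))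
      go (nc-conj {u} h x) g c = h-trans (go x (h · g) c)
        (blocks-cong R (FS.solve (c ∷ g ∷ u ∷ h ∷ []) (v₀ ^ᵉ (v₂ ^ᵉ (v₃ ⊙ v₁))) (v₀ ^ᵉ ((v₂ ^ᵉ v₃) ^ᵉ v₁)) refl))
      go (nc-resp {u} {v} q x) g c = h-trans (go x g c) (blocks-cong R (^-congʳ (F.∙-congʳ {g} (F.∙-congˡ {g ⁻¹} q))))
        where
        ^-congʳ : ∀ {x y} → x ≈ y → c ^ x ≈ c ^ y
        ^-congʳ q = F.∙-cong (F.∙-congʳ {c} (F.⁻¹-cong q)) q

-- The tuples FTLs2

module _ {A : Set} where
  lookup-∷ʳ-inject₁ : ∀ {n} (xs : Vec A n) x j → lookup (xs Vec.∷ʳ x) (inject₁ j) ≡ lookup xs j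
  lookup-∷ʳ-inject₁ (y ∷ xs) x Fin.zero    = refl
  lookup-∷ʳ-inject₁ (y ∷ xs) x (Fin.suc j) = lookup-∷ʳ-inject₁ xs x j

  lookup-∷ʳ-fromℕ : ∀ {n} (xs : Vec A n) x → lookup (xs Vec.∷ʳ x) (fromℕ n) ≡ x
  lookup-∷ʳ-fromℕ []       x = refl
  lookup-∷ʳ-fromℕ (y ∷ xs) x = lookup-∷ʳ-fromℕ xs x

  take-++ : ∀ {m n} (xs : Vec A m) (ys : Vec A n) → Vec.take m (xs Vec.++ ys) ≡ xs
  take-++ []       ys = refl
  take-++ (x ∷ xs) ys = cong (x ∷_) (take-++ xs ys)

  drop-++ : ∀ {m n} (xs : Vec A m) (ys : Vec A n) → Vec.drop m (xs Vec.++ ys) ≡ ys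
  drop-++ []       ys = refl
  drop-++ (x ∷ xs) ys = drop-++ xs ys

zipPairs : ∀ {n} → Vec (Word k) n → Vec (Word l) n → List (Pair k l)
zipPairs xs ys = Vec.toList (Vec.zipWith _,_ xs ys)

All-zipPairs : ∀ {n} {S : Pair k l → Set} {xs : Vec (Word k) n} {ys : Vec (Word l) n} →
               (∀ j → S (lookup xs j , lookup ys j)) → All S (zipPairs xs ys)
All-zipPairs {S = S} {xs} {ys} p = VecAll.toList⁺ (VecAll.lookup⁻
  (λ j → subst S (sym (lookup-zipWith _,_ j xs ys)) (p j)))

∈-zipPairs : ∀ {n} (xs : Vec (Word k) n) (ys : Vec (Word l) n) j → (lookup xs j , lookup ys j) ∈ zipPairs xs ys
∈-zipPairs xs ys j = subst (_∈ zipPairs xs ys) (lookup-zipWith _,_ j xs ys)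
  (VecMembership.∈-toList⁺ (VecMembership.∈-lookup j (Vec.zipWith _,_ xs ys)))

-- `P` reads its last two entries through a `with` on `V.drop`, which computes once the rewrites
-- expose them.
P-++ : ∀ {p q} (R : Vec (Word k) p) (W : Vec (Word k) q) c (X : Vec (Word l) q) (y z : Word l) →
       P R W c (X Vec.++ y ∷ z ∷ []) ≡
       map (λ r → r , ε) (Vec.toList R) ++ zipPairs W X ++ (c ⁻¹ , y) ∷ (c , z) ∷ []
P-++ R W c X y z
  rewrite drop-++ X (y ∷ z ∷ []) | take-++ X (y ∷ z ∷ []) = refl

prod-closed : (S : Word k → Set) → S ε → (∀ {u v} → S u → S v → S (u · v)) →
              ∀ {n} (xs : Vec (Word k) n) → (∀ j → S (lookup xs j)) → S (prod xs)
prod-closed S one mul []       p = one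
prod-closed S one mul (_ ∷ xs) p = mul (p Fin.zero) (prod-closed S one mul xs (p ∘ Fin.suc))

prod-∷ʳ : ∀ {n} (xs : Vec (Word k) n) x → prod (xs Vec.∷ʳ x) ≡ prod xs · x
prod-∷ʳ []       x = ++-identityʳ x
prod-∷ʳ (y ∷ xs) x = trans (cong (y ·_) (prod-∷ʳ xs x)) (sym (++-assoc y (prod xs) x))

prod-∷ʳ-⁻¹ : ∀ {n} (xs : Vec (Word k) n) → prod (xs Vec.∷ʳ prod xs ⁻¹) ≈ ε
prod-∷ʳ-⁻¹ xs = ≈-trans (≡⇒≈ (prod-∷ʳ xs _)) (·-inverseʳ (prod xs))

prod-toList : ∀ {n} (xs : Vec (Word k) n) → foldr _·_ ε (Vec.toList xs) ≡ prod xs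
prod-toList []       = refl
prod-toList (x ∷ xs) = cong (x ·_) (prod-toList xs)

prodL-zipPairs : ∀ {n} (xs : Vec (Word k) n) (ys : Vec (Word l) n) → prodL (zipPairs xs ys) ≡ (prod xs , prod ys)
prodL-zipPairs []       []       = refl
prodL-zipPairs (x ∷ xs) (y ∷ ys) = cong ((x , y) ·₂_) (prodL-zipPairs xs ys)

-- The quotient by the normal closure

record Congruent {m} (V : Vec (Word k) m) (u v : Word k) : Set where
  constructor congruent
  field difference : InNormalClosure V (u ⁻¹ · v)

≈⇒congruent : ∀ {m} {V : Vec (Word k) m} {u v} → u ≈ v → Congruent V u v
≈⇒congruent {u = u} p = congruent (nc-resp (≈-trans (≈-sym (·-inverseˡ u)) (·-congˡ (u ⁻¹) p)) nc-one)

-- Normality enters in `∙-cong` and `⁻¹-cong`, where `nc-conj` carries a difference past a factor.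
quotient : ∀ {m} → Vec (Word k) m → Group _ _
quotient {k} V = record
  { Carrier = Word k ; _≈_ = Congruent V ; _∙_ = _·_ ; ε = ε ; _⁻¹ = _⁻¹
  ; isGroup = record
    { isMonoid = record
      { isSemigroup = record
        { isMagma = record
          { isEquivalence = record
            { refl  = ≈⇒congruent ≈-refl
            ; sym   = λ { {u} {v} (congruent p) →
                resp (solve (u ∷ v ∷ []) ((v₀ ⊖ ⊙ v₁) ⊖) (v₁ ⊖ ⊙ v₀) refl) (nc-inv p) }
            ; trans = λ { {u} {v} {w} (congruent p) (congruent q) →
                resp (solve (u ∷ v ∷ w ∷ []) ((v₀ ⊖ ⊙ v₁) ⊙ (v₁ ⊖ ⊙ v₂)) (v₀ ⊖ ⊙ v₂) refl) (nc-mul p q) } }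
          ; ∙-cong = λ { {u} {u′} {v} {v′} (congruent p) (congruent q) →
              resp (solve (u ∷ u′ ∷ v ∷ v′ ∷ []) ((v₀ ⊖ ⊙ v₁) ^ᵉ v₂ ⊙ (v₂ ⊖ ⊙ v₃)) ((v₀ ⊙ v₂) ⊖ ⊙ (v₁ ⊙ v₃)) refl)
                (nc-mul (nc-conj v p) q) } }
        ; assoc = λ u v w → ≈⇒congruent (assoc u v w) }
      ; identity = (λ u → ≈⇒congruent ≈-refl) , (λ u → ≈⇒congruent (identityʳ u)) }
    ; inverse = (λ u → ≈⇒congruent (inverseˡ u)) , (λ u → ≈⇒congruent (inverseʳ u))
    ; ⁻¹-cong = λ { {u} {v} (congruent p) →
        resp (solve (u ∷ v ∷ []) (((v₀ ⊖ ⊙ v₁) ⊖) ^ᵉ (v₀ ⊖)) (v₀ ⊖ ⊖ ⊙ v₁ ⊖) refl) (nc-conj (u ⁻¹) (nc-inv p)) } } }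
  where
  open Group (freeGroup k) using (assoc; identityʳ; inverseˡ; inverseʳ)
  open Solver (freeGroup k)
  resp : ∀ {u v w} → w ≈ u ⁻¹ · v → InNormalClosure V w → Congruent V u v
  resp p q = congruent (nc-resp p q)

^-fixed⇒commute : (x g : Word k) → x ≈ x ^ g → x · g ≈ g · x
^-fixed⇒commute {k} x g p = ≈-trans
  (solve (x ∷ g ∷ []) (v₀ ⊙ v₁) (v₁ ⊙ (v₀ ^ᵉ v₁)) refl) (·-congˡ g (≈-sym p))
  where open Solver (freeGroup k)

-- The blocks of a tuple and the graph of a homomorphism

module Tuples {n m : ℕ} (V : Vec (Word n) m) where
  top : Fin (suc n)
  top = fromℕ n

  X : Word (suc n)
  X = gen top

  z : Vec (Word n) n
  z = Vec.tabulate gen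

  x : Vec (Word (suc n)) n
  x = Vec.tabulate (λ j → gen (inject₁ j))

  middle : List (Pair n (suc n))
  middle = zipPairs (z Vec.∷ʳ prod z ⁻¹) (x Vec.∷ʳ prod x ⁻¹)

  tuple : Word n → List (Pair n (suc n))
  tuple c = map (λ r → r , ε) (Vec.toList (Vf V)) ++ middle ++ (c ⁻¹ , X ⁻¹) ∷ (c , X) ∷ []

  P≡tuple : ∀ c → P (Vf V) (Wz n) c (Xs n) ≡ tuple c
  P≡tuple c = P-++ (Vf V) (Wz n) c (x Vec.∷ʳ prod x ⁻¹) (X ⁻¹) X

  ∀-lookup-∷ʳ : ∀ {A B : Set} {j} {xs : Vec A j} {ys : Vec B j} {a b} {S : A → B → Set} →
                (∀ i → S (lookup xs i) (lookup ys i)) → S a b →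
                ∀ i → S (lookup (xs Vec.∷ʳ a) i) (lookup (ys Vec.∷ʳ b) i)
  ∀-lookup-∷ʳ {xs = xs} {ys} {a} {b} {S} p q i with view i
  ... | ‵fromℕ     = subst₂ S (sym (lookup-∷ʳ-fromℕ xs a)) (sym (lookup-∷ʳ-fromℕ ys b)) q
  ... | ‵inject₁ j = subst₂ S (sym (lookup-∷ʳ-inject₁ xs a j)) (sym (lookup-∷ʳ-inject₁ ys b j)) (p j)

  middle-trivial : prodL middle ≈₂ (ε , ε)
  middle-trivial = subst (_≈₂ (ε , ε)) (sym (prodL-zipPairs (z Vec.∷ʳ prod z ⁻¹) (x Vec.∷ʳ prod x ⁻¹)))
    (prod-∷ʳ-⁻¹ z , prod-∷ʳ-⁻¹ x)

  middle-covers : ∀ j → ∃[ q ] (gen j , q) ∈ middle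
  middle-covers j = q ,
    subst (λ w → (w , q) ∈ middle)
      (trans (lookup-∷ʳ-inject₁ z (prod z ⁻¹) j) (lookup∘tabulate gen j))
      (∈-zipPairs (z Vec.∷ʳ prod z ⁻¹) (x Vec.∷ʳ prod x ⁻¹) (inject₁ j))
    where q = lookup (x Vec.∷ʳ prod x ⁻¹) (inject₁ j)

  conjugate-equivalent : (i : Pair n (suc n) → G) → IsInjectiveHom i → ∀ {u} → InNormalClosure V u →
                         ∀ {c c′} → c ^ u ≈ c′ → Hurwitz (map i (tuple c)) (map i (tuple c′))
  conjugate-equivalent i isHom {u} u∈N {c} p = h-trans
    -- The auxiliary outer conjugator is taken to be `ε`.
    (blocks-normalClosure {V = V} (≈-trans (≡⇒≈ (prod-toList (Vf V))) (prod-∷ʳ-⁻¹ V)) V⊆Vf u∈N ε c)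
    (blocks-cong (Vec.toList (Vf V)) (≈-trans (solve (c ∷ u ∷ []) (v₀ ^ᵉ (v₁ ^ᵉ 𝟙)) (v₀ ^ᵉ v₁) refl) p))
    where
    open Image i isHom
    open ThreeBlocks middle middle-trivial middle-covers X
    open Solver (freeGroup n)
    V⊆Vf : ∀ j → lookup V j ∈ Vec.toList (Vf V)
    V⊆Vf j = subst (_∈ Vec.toList (Vf V)) (lookup-∷ʳ-inject₁ V _ j)
      (VecMembership.∈-toList⁺ (VecMembership.∈-lookup (inject₁ j) (Vf V)))

  private module N = Group (quotient V)
  open N using () renaming (_≈_ to _∼_)

  ∼ε⇒∈ : ∀ {u} → u ∼ ε → InNormalClosure V u
  ∼ε⇒∈ {u} (congruent p) = nc-resp (≈-trans (≡⇒≈ (cong _⁻¹ (++-identityʳ (u ⁻¹)))) (⁻¹-involutive u)) (nc-inv p)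
    where open GroupProperties (freeGroup n) using (⁻¹-involutive)

  ∈⇒∼ε : ∀ {u} → InNormalClosure V u → u ∼ ε
  ∈⇒∼ε {u} p = congruent (nc-resp (≈-sym (≡⇒≈ (++-identityʳ (u ⁻¹)))) (nc-inv p))

  -- φ kills X and sends the other generators X_j to z_j.  Modulo N, the entries of a tuple lie on
  -- the graph of φ.
  φ-gen : {j : Fin (suc n)} → View j → Word n
  φ-gen ‵fromℕ       = ε
  φ-gen (‵inject₁ j) = gen j

  open Lift (quotient V) using (lift; lift-·; lift-⁻¹; lift-cong)

  φ : Word (suc n) → Word n
  φ = lift (λ j → φ-gen (view j))

  OnGraph : Pair n (suc n) → Set
  OnGraph (p , q) = p ∼ φ q

  onGraph-resp : ∀ {k k′} → k ≈₂ k′ → OnGraph k → OnGraph k′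
  onGraph-resp {p , q} {p′ , q′} (e , f) g =
    N.trans (≈⇒congruent (≈-sym e)) (N.trans g (lift-cong _ f))

  onGraph-· : ∀ {k k′} → OnGraph k → OnGraph k′ → OnGraph (k ·₂ k′)
  onGraph-· {p , q} {p′ , q′} g g′ = N.trans (N.∙-cong g g′) (N.sym (lift-· _ q q′))

  onGraph-⁻¹ : ∀ {k} → OnGraph k → OnGraph (k ⁻¹₂)
  onGraph-⁻¹ {p , q} g = N.trans (N.⁻¹-cong g) (N.sym (lift-⁻¹ _ q))

  onGraph-^ : ∀ {k g} → OnGraph k → OnGraph g → OnGraph (k ^₂ g)
  onGraph-^ {k} {g} s t = onGraph-· {g ⁻¹₂ ·₂ k} (onGraph-· {g ⁻¹₂} (onGraph-⁻¹ {g} t) s) t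

  onGraph-ε : OnGraph (ε , ε)
  onGraph-ε = N.refl

  onGraph-gen : ∀ j → OnGraph (lookup z j , lookup x j)
  onGraph-gen j rewrite lookup∘tabulate {A = Word n} gen j
    | lookup∘tabulate {A = Word (suc n)} (λ i → gen (inject₁ i)) j
    | view-inject₁ j = N.refl

  onGraph-prod : ∀ {j} (ps : Vec (Word n) j) (qs : Vec (Word (suc n)) j) →
                 (∀ i → OnGraph (lookup ps i , lookup qs i)) → OnGraph (prod ps , prod qs)
  onGraph-prod []       []       s = onGraph-ε
  onGraph-prod (p ∷ ps) (q ∷ qs) s = onGraph-· {p , q} (s Fin.zero) (onGraph-prod ps qs (s ∘ Fin.suc))

  onGraph-∈ : ∀ {u} → InNormalClosure V u → OnGraph (u , ε)
  onGraph-∈ = ∈⇒∼ε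

  -- `φ` sends `X` to `ε`. This puts the marked entry on the graph, its first coordinate being a
  -- conjugate of an element of `N`.
  onGraph-X : ∀ {u} → InNormalClosure V u → OnGraph (u , X)
  onGraph-X u∈N rewrite view-fromℕ n = ∈⇒∼ε u∈N

  e : Word (suc n) → ℤ
  e = exponent top

  e-⁻¹ : ∀ {q} → e q ≡ + 0 → e (q ⁻¹) ≡ + 0
  e-⁻¹ {q} p = trans (Lift.lift-⁻¹ ℤ-group (indicator top) q) (cong ℤ.-_ p)

  e-x : ∀ j → e (lookup x j) ≡ + 0
  e-x j rewrite lookup∘tabulate {A = Word (suc n)} (λ i → gen (inject₁ i)) j =
    exponent-gen-≢ top {inject₁ j} (λ p → Fin.fromℕ≢inject₁ (sym p))

  e-prod : e (prod x) ≡ + 0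
  e-prod = prod-closed (λ q → e q ≡ + 0) refl
    (λ {u} {v} p q → trans (Lift.lift-· ℤ-group (indicator top) u v) (cong₂ ℤ._+_ p q)) x e-x

  -- The sign of the exponent sum separates the marked entry from its partner `(c ⁻¹ , X ⁻¹)`.
  e-X⁻¹ : e (X ⁻¹) ≢ + 1
  e-X⁻¹ p = case trans (sym p) (trans (Lift.lift-⁻¹ ℤ-group (indicator top) X) (cong ℤ.-_ (exponent-gen top))) of λ ()

  -- Following the marked entry through an equivalence

  module Tracking (i : Pair n (suc n) → G) (isHom : IsInjectiveHom i) (c : Word n) (c∈N : InNormalClosure V c) where
    open Image i isHom
    open IsInjectiveHom isHom
    private
      module 𝔾 = Group (pairGroup 2 2)
      module 𝕂 = Group (pairGroup n (suc n))
    open Solver (pairGroup n (suc n))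

    FromMarked : Pair n (suc n) → Set
    FromMarked k = ∃[ g ] (OnGraph g × k ≈₂ (c , X) ^₂ g)

    -- Among the conjugates of entries of the tuple, those of (c , X) are recognised by the
    -- exponent sum of X.
    Tracked : Pair n (suc n) → Set
    Tracked k = OnGraph k × (e (proj₂ k) ≡ + 1 → FromMarked k)

    -- Conjugation preserves the exponent sum, so if `k ^₂ h` has sum 1 then so does `k`; the
    -- conjugator `g` of `k` extends to `g ·₂ h`, still on the graph.
    tracked-^ : ∀ {k h} → Tracked k → OnGraph h → Tracked (k ^₂ h)
    tracked-^ {k} {h} (s , marked) t = onGraph-^ {k} {h} s t , λ p →
      let g , u , q = marked (trans (sym (exponent-^ top (proj₂ k) (proj₂ h))) p)
      in g ·₂ h , onGraph-· {g} u t , 𝕂.trans (^₂-cong h q)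
           (solve ((c , X) ∷ g ∷ h ∷ []) ((v₀ ^ᵉ v₁) ^ᵉ v₂) (v₀ ^ᵉ (v₁ ⊙ v₂)) refl)

    -- Intermediate tuples of an equivalence live in `G`, so a preimage is carried along with each
    -- entry.
    TrackedImage : G → Set
    TrackedImage y = ∃[ k ] (y ≈₂ i k × Tracked k)

    tracked-hurwitz : ∀ {s t} → Hurwitz s t → All TrackedImage s → All TrackedImage t
    tracked-hurwitz p = proj₁ (hurwitz-All
      (λ q (k , r , s) → k , 𝔾.trans (𝔾.sym q) r , s)
      (λ { (k , p , s) (h , q , t) → k ^₂ h ,
          𝔾.trans (𝔾.∙-cong (𝔾.∙-cong (𝔾.⁻¹-cong q) p) q) (𝔾.sym (hom-^ k h)) , tracked-^ {k} {h} s (proj₁ t) })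
      (λ { (k , p , s) (h , q , t) → k ^₂ (h ⁻¹₂) ,
          𝔾.trans (𝔾.∙-cong (𝔾.∙-cong (𝔾.⁻¹-cong (𝔾.⁻¹-cong q)) p) (𝔾.⁻¹-cong q)) (𝔾.sym (hom-^⁻¹ k h)) ,
          tracked-^ {k} {h ⁻¹₂} s (onGraph-⁻¹ {h} (proj₁ t)) })
      p)

    unmarked : ∀ {k} → OnGraph k → e (proj₂ k) ≡ + 0 → Tracked k
    unmarked s p = s , λ q → case trans (sym p) q of λ ()

    tracked-tuple : All Tracked (tuple c)
    tracked-tuple = All.++⁺ first (All.++⁺ second
      ((onGraph-⁻¹ {c , X} (onGraph-X c∈N) , λ q → contradiction q e-X⁻¹) ∷
       (onGraph-X c∈N , λ _ → (ε , ε) , onGraph-ε , solve ((c , X) ∷ []) v₀ (v₀ ^ᵉ 𝟙) refl) ∷ []))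
      where
      first : All Tracked (map (λ r → r , ε) (Vec.toList (Vf V)))
      first = All.map⁺ (VecAll.toList⁺ (VecAll.lookup⁻ {xs = Vf V} (λ j →
        unmarked {lookup (Vf V) j , ε} (onGraph-∈ (∀-lookup-∷ʳ {xs = V} {V} {b = prod V ⁻¹} {S = λ u _ → InNormalClosure V u} nc-gen
          (nc-inv (prod-closed (InNormalClosure V) nc-one nc-mul V nc-gen)) j)) refl)))
      second : All Tracked middle
      second = All-zipPairs (∀-lookup-∷ʳ {xs = z} {x} {S = λ p q → Tracked (p , q)}
        (λ j → unmarked {lookup z j , lookup x j} (onGraph-gen j) (e-x j))
        (unmarked {prod z ⁻¹ , prod x ⁻¹} (onGraph-⁻¹ {prod z , prod x} (onGraph-prod z x onGraph-gen)) (e-⁻¹ {prod x} e-prod)))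

    equivalent⇒marked-conjugate : ∀ {c′} → Hurwitz (map i (tuple c)) (map i (tuple c′)) →
                                  ∃[ p ] (InNormalClosure V p × c′ ≈ c ^ p)
    equivalent⇒marked-conjugate {c′} h = conclude lastTracked
      where
      lastTracked : TrackedImage (i (c′ , X))
      lastTracked = case All.++⁻ʳ middle (All.++⁻ʳ (map (λ r → r , ε) (Vec.toList (Vf V)))
          (All.map⁻ (tracked-hurwitz h (All.map⁺ (All.map (λ {k} t → k , 𝔾.refl , t) tracked-tuple)))))
        of λ { (_ ∷ t ∷ []) → t }
      conclude : TrackedImage (i (c′ , X)) → ∃[ p ] (InNormalClosure V p × c′ ≈ c ^ p)
      conclude (k , q , s , marked) =
        -- Injectivity identifies the preimage `k` with `(c′ , X)`, whose exponent sum is 1; this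
        -- releases the conjugator `(p , r)`.
        let c′≈ , X≈ = injective q
            (p , r) , g , ≈c , ≈X = marked (trans (Lift.lift-cong ℤ-group (indicator top) (≈-sym X≈)) (exponent-gen top))
        in p , ∼ε⇒∈ (N.trans g (N.sym (centralizer-onGraph r (≈-trans X≈ ≈X)))) , ≈-trans c′≈ ≈c
        where
        centralizer-onGraph : ∀ r → X ≈ X ^ r → OnGraph (ε , r)
        centralizer-onGraph r f =
          -- The generator `X` is rootless, so `r` is a power of `X`, and `φ` kills it.
          let j , r≈ = centralizer-cyclic (gen-noRoot top) (^-fixed⇒commute X r f)
          in onGraph-resp {ε , pow X j} (≈-refl , ≈-sym r≈)
               (pow-closed (λ w → OnGraph (ε , w)) onGraph-ε
                 (λ {u} {v} → onGraph-· {ε , u} {ε , v}) (λ {u} → onGraph-⁻¹ {ε , u}) {X} (onGraph-X nc-one) j)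

-- Comparing conjugators of a rootless element

module _ {k : ℕ} where
  open Solver (freeGroup k)

  -- Two conjugators with the same effect on `A`, here `a · p` and `b`, differ by an element of its
  -- centralizer.
  ^-agree⇒commute : ∀ (A a b p : Word k) → A ^ b ≈ (A ^ a) ^ p → A · (a · p · b ⁻¹) ≈ (a · p · b ⁻¹) · A
  ^-agree⇒commute A a b p q = ≈-trans
    (solve (A ∷ a ∷ b ∷ p ∷ []) (v₀ ⊙ (v₁ ⊙ v₃ ⊙ v₂ ⊖)) ((v₁ ⊙ v₃) ⊙ ((v₀ ^ᵉ v₁) ^ᵉ v₃) ⊙ v₂ ⊖) refl)
    (≈-trans (·-congʳ (b ⁻¹) (·-congˡ (a · p) (≈-sym q)))
      (solve (A ∷ a ∷ b ∷ p ∷ []) ((v₁ ⊙ v₃) ⊙ (v₀ ^ᵉ v₂) ⊙ v₂ ⊖) ((v₁ ⊙ v₃ ⊙ v₂ ⊖) ⊙ v₀) refl))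

  ^-agree⇒congruent : ∀ {m} {V : Vec (Word k) m} {A a b p} → InNormalClosure V A → ¬ HasRoot A →
                      InNormalClosure V p → A ^ b ≈ (A ^ a) ^ p → InNormalClosure V (a ⁻¹ · b)
  ^-agree⇒congruent {V = V} {A} {a} {b} {p} A∈N n p∈N q =
    let j , y≈ = centralizer-cyclic n (^-agree⇒commute A a b p q)
        y∈N = nc-resp (≈-sym y≈) (pow-closed (InNormalClosure V) nc-one nc-mul nc-inv A∈N j)
    -- With `y = a · p · b ⁻¹` a power of `A`, the word `a ⁻¹ · b` equals `(y ⁻¹) ^ a · p`, a
    -- product of two elements of `N`.
    in nc-resp (solve (a ∷ b ∷ p ∷ []) (((v₀ ⊙ v₂ ⊙ v₁ ⊖) ⊖) ^ᵉ v₀ ⊙ v₂) (v₀ ⊖ ⊙ v₁) refl)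
         (nc-mul (nc-conj a (nc-inv y∈N)) p∈N)

theorem4p6 : (n : ℕ) → 2 ≤ n → (m : ℕ) → (V : Vec (Word n) m) →
    (∃[ j ] ¬ (lookup V j ≈ ε)) →
    (i : Pair n (suc n) → G) → IsInjectiveHom i →
    (H : Word n) → InNormalClosure V H → ¬ HasRoot H →
    (a b : Word n) →
    Hurwitz (FTLs2 i V H a) (FTLs2 i V H b) ⇔ InNormalClosure V (a ⁻¹ · b)
theorem4p6 n _ m V _ i isHom H H∈N noRoot a b
  rewrite Tuples.P≡tuple V (H ^ a) | Tuples.P≡tuple V (H ^ b) = mk⇔ equivalent⇒ ⇒equivalent
  where
  open Tuples V
  equivalent⇒ : Hurwitz (map i (tuple (H ^ a))) (map i (tuple (H ^ b))) → InNormalClosure V (a ⁻¹ · b)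
  equivalent⇒ h =
    let p , p∈N , q = Tracking.equivalent⇒marked-conjugate i isHom (H ^ a) (nc-conj a H∈N) h
    in ^-agree⇒congruent {a = a} {b} H∈N noRoot p∈N q
  ⇒equivalent : InNormalClosure V (a ⁻¹ · b) → Hurwitz (map i (tuple (H ^ a))) (map i (tuple (H ^ b)))
  -- Conjugating `H ^ a` by `a ⁻¹ · b` gives `H ^ b`.
  ⇒equivalent u∈N = conjugate-equivalent i isHom u∈N
    (Solver.solve (freeGroup n) (H ∷ a ∷ b ∷ []) ((v₀ ^ᵉ v₁) ^ᵉ (v₁ ⊖ ⊙ v₂)) (v₀ ^ᵉ v₂) refl)
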